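{- Let $k_2=\frac{1}{8\cdot3^{2/3}}$. Then for every integer $\nu\ge1$, $c_\nu\ge\frac14+k_2\nu^{ -2/3}$.
   Context: A weighted digraph $D=(V,A,w)$ is a digraph without loops or parallel arcs (opposite arcs allowed) with weights $w:A\to\mathbb{R}_{\ge0}$; $w(D)$ is the total arc weight. For a partition $(X,Y)$ of $V$, $w(X,Y)$ is the total weight of arcs from $X$ to $Y$, and $\mathrm{mac}(D)=\max_{(X,Y)}w(X,Y)$. For an integer $\nu\ge1$, $c_\nu$ is the supremum of reals $c\ge0$ such that every acyclic weighted digraph $D$ whose longest directed path has exactly $\nu$ vertices satisfies $\mathrm{mac}(D)\ge c\cdot w(D)$. -}

module Defs where

open import Data.Bool.Base using (Bool; T; if_then_else_)
open import Data.Bool.Properties using (T?)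
open import Data.Fin.Base using (Fin)
open import Data.Fin.Subset using (Subset; inside; outside)
open import Data.Fin.Subset.Properties using (_∈?_)
open import Data.Integer.Base as ℤ using (+_; -[1+_])
import Data.Integer.Properties as ℤₚ
open import Data.List.Base using (List; []; _∷_; _∷ʳ_; length)
open import Data.List.Relation.Unary.Linked using (Linked)
open import Data.List.Relation.Unary.Unique.Propositional using (Unique)
open import Data.Nat.Base as ℕ using (ℕ; zero; suc)
import Data.Nat.Properties as ℕₚ
open import Data.Product.Base using (∃-syntax; _×_; _,_; proj₁; proj₂)
open import Data.Rational.Base
open import Data.Rational.Properties
open import Data.Rational.Solver using (module +-*-Solver)
import Data.Rational.Unnormalised.Base as ℚᵘ
import Data.Rational.Unnormalised.Properties as ℚᵘₚ
open import Data.Sum.Base using (inj₁; inj₂)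
open import Data.Vec.Base using ([]; _∷_)
open import Data.Vec.Functional using (foldr)
open import Relation.Binary.PropositionalEquality
open import Relation.Nullary using (¬_; Dec; does; yes; no; contradiction)
open import Relation.Nullary.Decidable using (_×-dec_; ¬?)

open +-*-Solver using (solve; _:+_; _:*_; :-_; _:-_; _:=_; con)

------------------------------------------------------------------------
-- Auxiliary facts about ℚ

½-pos : ∀ {ε} → 0ℚ < ε → 0ℚ < ½ * ε
½-pos {ε} 0<ε =
  positive⁻¹ (½ * ε) {{pos*pos⇒pos ½ ε {{positive 0<ε}}}}

½+½ : ∀ ε → ½ * ε + ½ * ε ≡ ε
½+½ = solve 1 (λ ε → con ½ :* ε :+ con ½ :* ε := ε) refl

p≤∣p∣ : ∀ p → p ≤ ∣ p ∣
p≤∣p∣ p with ≤-total 0ℚ p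
... | inj₁ 0≤p = ≤-reflexive (sym (0≤p⇒∣p∣≡p 0≤p))
... | inj₂ p≤0 = ≤-trans p≤0 (0≤∣p∣ p)

∣-∣-swap : ∀ p q → ∣ p - q ∣ ≡ ∣ q - p ∣
∣-∣-swap p q = trans (sym (∣-p∣≡∣p∣ (p - q)))
  (cong ∣_∣ (solve 2 (λ p q → :- (p :- q) := q :- p) refl p q))

∣-∣≤⇒≤ : ∀ {p q ε} → ∣ p - q ∣ ≤ ε → p ≤ q + ε
∣-∣≤⇒≤ {p} {q} {ε} h = begin
  p            ≡⟨ solve 2 (λ p q → p := q :+ (p :- q)) refl p q ⟩
  q + (p - q)  ≤⟨ +-monoʳ-≤ q (≤-trans (p≤∣p∣ (p - q)) h) ⟩
  q + ε        ∎
  where open ≤-Reasoning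

≤⇒-≤ : ∀ {p q ε} → p ≤ q + ε → p - q ≤ ε
≤⇒-≤ {p} {q} {ε} h = begin
  p - q        ≤⟨ +-monoˡ-≤ (- q) h ⟩
  q + ε - q    ≡⟨ solve 2 (λ q ε → q :+ ε :- q := ε) refl q ε ⟩
  ε            ∎
  where open ≤-Reasoning

≤⇒∣-∣≤ : ∀ {p q ε} → p ≤ q + ε → q ≤ p + ε → ∣ p - q ∣ ≤ ε
≤⇒∣-∣≤ {p} {q} {ε} h k with ∣p∣≡p∨∣p∣≡-p (p - q)
... | inj₁ e = ≤-trans (≤-reflexive e) (≤⇒-≤ h)
... | inj₂ e = ≤-trans (≤-reflexive
  (trans e (solve 2 (λ p q → :- (p :- q) := q :- p) refl p q))) (≤⇒-≤ k)

*-nonNeg : ∀ {p q} → 0ℚ ≤ p → 0ℚ ≤ q → 0ℚ ≤ p * q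
*-nonNeg {p} {q} 0≤p 0≤q = nonNegative⁻¹ (p * q)
  {{nonNeg*nonNeg⇒nonNeg p {{nonNegative 0≤p}} q {{nonNegative 0≤q}}}}

*-mono-≤-nonNeg : ∀ {p q r s} → 0ℚ ≤ p → 0ℚ ≤ s → p ≤ q → r ≤ s → p * r ≤ q * s
*-mono-≤-nonNeg {p} {q} {r} {s} 0≤p 0≤s p≤q r≤s = ≤-trans
  (*-monoˡ-≤-nonNeg p {{nonNegative 0≤p}} r≤s)
  (*-monoʳ-≤-nonNeg s {{nonNegative 0≤s}} p≤q)

infix 9 _³
_³ : ℚ → ℚ
p ³ = p * p * p

³-mono-≤ : ∀ {p q} → 0ℚ ≤ p → p ≤ q → p ³ ≤ q ³
³-mono-≤ 0≤p p≤q =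
  *-mono-≤-nonNeg (*-nonNeg 0≤p 0≤p) 0≤q (*-mono-≤-nonNeg 0≤p 0≤q p≤q p≤q) p≤q
  where 0≤q = ≤-trans 0≤p p≤q

fromℕ : ℕ → ℚ
fromℕ zero    = 0ℚ
fromℕ (suc n) = 1ℚ + fromℕ n

fromℕ-nonNeg : ∀ n → 0ℚ ≤ fromℕ n
fromℕ-nonNeg zero    = ≤-refl
fromℕ-nonNeg (suc n) = +-mono-≤ (nonNegative⁻¹ 1ℚ) (fromℕ-nonNeg n)

fromℕ-pos : ∀ n → 0ℚ < fromℕ (suc n)
fromℕ-pos n = +-mono-<-≤ (positive⁻¹ 1ℚ) (fromℕ-nonNeg n)

fromℕ-mono : ∀ {m n} → m ℕ.≤ n → fromℕ m ≤ fromℕ n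
fromℕ-mono {n = n} ℕ.z≤n = fromℕ-nonNeg n
fromℕ-mono (ℕ.s≤s m≤n)   = +-monoʳ-≤ 1ℚ (fromℕ-mono m≤n)

toℚᵘ-fromℕ : ∀ n → toℚᵘ (fromℕ n) ℚᵘ.≃ ℚᵘ.mkℚᵘ (+ n) 0
toℚᵘ-fromℕ zero    = ℚᵘₚ.≃-refl
toℚᵘ-fromℕ (suc n) = ℚᵘₚ.≃-trans (toℚᵘ-homo-+ 1ℚ (fromℕ n))
  (ℚᵘₚ.≃-trans (ℚᵘₚ.+-congʳ ℚᵘ.1ℚᵘ (toℚᵘ-fromℕ n))
    (ℚᵘ.*≡* (cong (λ k → (+ 1 ℤ.+ k) ℤ.* + 1) (ℤₚ.*-identityʳ (+ n)))))

≤-fromℕ : ∀ p → ∃[ N ] p ≤ fromℕ N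
≤-fromℕ p = ℤ.∣ ↥ p ∣ , toℚᵘ-cancel-≤ (ℚᵘₚ.≤-trans (bound p)
  (ℚᵘₚ.≤-reflexive (ℚᵘₚ.≃-sym (toℚᵘ-fromℕ ℤ.∣ ↥ p ∣))))
  where
  bound : ∀ p → toℚᵘ p ℚᵘ.≤ ℚᵘ.mkℚᵘ (+ ℤ.∣ ↥ p ∣) 0
  bound (mkℚ (+ n) d _) = ℚᵘ.*≤* (begin
    + n ℤ.* + 1      ≡⟨ ℤₚ.pos-* n 1 ⟨
    + (n ℕ.* 1)      ≤⟨ ℤ.+≤+ (ℕₚ.*-monoʳ-≤ n (ℕ.s≤s ℕ.z≤n)) ⟩
    + (n ℕ.* suc d)  ≡⟨ ℤₚ.pos-* n (suc d) ⟩
    + n ℤ.* + suc d  ∎)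
    where open ℤₚ.≤-Reasoning
  bound (mkℚ -[1+ n ] d _) = ℚᵘ.*≤* ℤ.-≤+

archimedean : ∀ p {ε} → 0ℚ < ε → ∃[ N ] p ≤ fromℕ N * ε
archimedean p {ε} 0<ε = N , (begin
  p                ≡⟨ *-identityʳ p ⟨
  p * 1ℚ           ≡⟨ cong (p *_) (*-inverseˡ ε) ⟨
  p * (1/ε * ε)    ≡⟨ *-assoc p 1/ε ε ⟨
  p * 1/ε * ε      ≤⟨ *-monoʳ-≤-nonNeg ε {{nonNegative (<⇒≤ 0<ε)}} (proj₂ (≤-fromℕ (p * 1/ε))) ⟩
  fromℕ N * ε      ∎)
  where
  open ≤-Reasoning
  instance _ = >-nonZero 0<ε
  1/ε = 1/ ε
  N   = proj₁ (≤-fromℕ (p * 1/ε))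

------------------------------------------------------------------------
-- Real numbers: Cauchy sequences of rationals with a modulus of convergence

IsCauchy : (ℕ → ℚ) → Set
IsCauchy x = ∀ ε → 0ℚ < ε →
  ∃[ N ] ∀ m n → N ℕ.≤ m → N ℕ.≤ n → ∣ x m - x n ∣ ≤ ε

record ℝ : Set where
  constructor mkℝ
  field
    seq    : ℕ → ℚ
    cauchy : IsCauchy seq

open ℝ public

infix  4 _≤ℝ_ _<ℝ_ _≃ℝ_
infixl 6 _+ℝ_ _⊔ℝ_
infixl 7 _*ℝ_

_≤ℝ_ : ℝ → ℝ → Set
x ≤ℝ y = ∀ ε → 0ℚ < ε → ∃[ N ] ∀ n → N ℕ.≤ n → seq x n ≤ seq y n + ε

_<ℝ_ : ℝ → ℝ → Set
x <ℝ y = ∃[ ε ] 0ℚ < ε × ∃[ N ] ∀ n → N ℕ.≤ n → seq x n + ε ≤ seq y n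

_≃ℝ_ : ℝ → ℝ → Set
x ≃ℝ y = x ≤ℝ y × y ≤ℝ x

fromℚ : ℚ → ℝ
fromℚ q = mkℝ (λ _ → q) λ ε 0<ε → 0 , λ _ _ _ _ →
  ≤-trans (≤-reflexive (cong ∣_∣ (+-inverseʳ q))) (<⇒≤ 0<ε)

0ℝ : ℝ
0ℝ = fromℚ 0ℚ

+-cauchy : ∀ {x y : ℕ → ℚ} → IsCauchy x → IsCauchy y → IsCauchy (λ n → x n + y n)
+-cauchy {x} {y} cx cy ε 0<ε = M ℕ.⊔ N , λ m n p q → begin
  ∣ (x m + y m) - (x n + y n) ∣
    ≡⟨ cong ∣_∣ (solve 4 (λ a b c d → (a :+ b) :- (c :+ d) := (a :- c) :+ (b :- d))
         refl (x m) (y m) (x n) (y n)) ⟩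
  ∣ (x m - x n) + (y m - y n) ∣
    ≤⟨ ∣p+q∣≤∣p∣+∣q∣ (x m - x n) (y m - y n) ⟩
  ∣ x m - x n ∣ + ∣ y m - y n ∣
    ≤⟨ +-mono-≤
         (proj₂ cx′ m n (ℕₚ.m⊔n≤o⇒m≤o M N p) (ℕₚ.m⊔n≤o⇒m≤o M N q))
         (proj₂ cy′ m n (ℕₚ.m⊔n≤o⇒n≤o M N p) (ℕₚ.m⊔n≤o⇒n≤o M N q)) ⟩
  ½ * ε + ½ * ε
    ≡⟨ ½+½ ε ⟩
  ε ∎
  where
  open ≤-Reasoning
  cx′ = cx (½ * ε) (½-pos 0<ε)
  cy′ = cy (½ * ε) (½-pos 0<ε)
  M = proj₁ cx′
  N = proj₁ cy′

_+ℝ_ : ℝ → ℝ → ℝ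
x +ℝ y = mkℝ (λ n → seq x n + seq y n) (+-cauchy {seq x} {seq y} (cauchy x) (cauchy y))

eventuallyBounded : ∀ {x} → IsCauchy x →
  ∃[ B ] 0ℚ < B × ∃[ N ] ∀ n → N ℕ.≤ n → ∣ x n ∣ ≤ B
eventuallyBounded {x} cx = B ,
  (begin-strict 0ℚ <⟨ positive⁻¹ 1ℚ ⟩ 1ℚ ≡⟨ +-identityˡ 1ℚ ⟨
     0ℚ + 1ℚ ≤⟨ +-monoˡ-≤ 1ℚ (0≤∣p∣ (x N)) ⟩ B ∎) ,
  N , λ n N≤n → begin
    ∣ x n ∣                  ≡⟨ cong ∣_∣ (solve 2 (λ a b → a := b :+ (a :- b)) refl (x n) (x N)) ⟩
    ∣ x N + (x n - x N) ∣    ≤⟨ ∣p+q∣≤∣p∣+∣q∣ (x N) (x n - x N) ⟩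
    ∣ x N ∣ + ∣ x n - x N ∣  ≤⟨ +-monoʳ-≤ ∣ x N ∣ (proj₂ c n N N≤n ℕₚ.≤-refl) ⟩
    B                        ∎
  where
  open ≤-Reasoning
  c = cx 1ℚ (positive⁻¹ 1ℚ)
  N = proj₁ c
  B = ∣ x N ∣ + 1ℚ

∣*∣≤ : ∀ {p q B ε} (0<B : 0ℚ < B) → ∣ p ∣ ≤ B →
  ∣ q ∣ ≤ (1/ B) {{>-nonZero 0<B}} * ε → ∣ p * q ∣ ≤ ε
∣*∣≤ {p} {q} {B} {ε} 0<B hp hq = begin
  ∣ p * q ∣         ≡⟨ ∣p*q∣≡∣p∣*∣q∣ p q ⟩
  ∣ p ∣ * ∣ q ∣     ≤⟨ *-mono-≤-nonNeg (0≤∣p∣ p) (≤-trans (0≤∣p∣ q) hq) hp hq ⟩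
  B * (1/ B * ε)    ≡⟨ *-assoc B (1/ B) ε ⟨
  B * 1/ B * ε      ≡⟨ cong (_* ε) (*-inverseʳ B) ⟩
  1ℚ * ε            ≡⟨ *-identityˡ ε ⟩
  ε                 ∎
  where
  open ≤-Reasoning
  instance _ = >-nonZero 0<B

1/-scaled-pos : ∀ {B ε} (0<B : 0ℚ < B) → 0ℚ < ε → 0ℚ < (1/ B) {{>-nonZero 0<B}} * ε
1/-scaled-pos {B} {ε} 0<B 0<ε = positive⁻¹ (1/B * ε)
  {{pos*pos⇒pos 1/B {{1/pos⇒pos B {{positive 0<B}}}} ε {{positive 0<ε}}}}
  where 1/B = (1/ B) {{>-nonZero 0<B}}

*-cauchy : ∀ {x y : ℕ → ℚ} → IsCauchy x → IsCauchy y → IsCauchy (λ n → x n * y n)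
*-cauchy {x} {y} cx cy ε 0<ε =
  product (eventuallyBounded {x} cx) (eventuallyBounded {y} cy)
  where
  open ≤-Reasoning
  δ : ∀ {B} → 0ℚ < B → ℚ
  δ {B} 0<B = (1/ B) {{>-nonZero 0<B}} * (½ * ε)

  close : ∀ {B C a b c d} (0<B : 0ℚ < B) (0<C : 0ℚ < C) →
    ∣ a ∣ ≤ B → ∣ b - d ∣ ≤ δ 0<B → ∣ d ∣ ≤ C → ∣ a - c ∣ ≤ δ 0<C →
    ∣ a * b - c * d ∣ ≤ ε
  close {a = a} {b} {c} {d} 0<B 0<C ha hbd hd hac = begin
    ∣ a * b - c * d ∣
      ≡⟨ cong ∣_∣ (solve 4 (λ a b c d → a :* b :- c :* d := a :* (b :- d) :+ d :* (a :- c))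
           refl a b c d) ⟩
    ∣ a * (b - d) + d * (a - c) ∣
      ≤⟨ ∣p+q∣≤∣p∣+∣q∣ (a * (b - d)) (d * (a - c)) ⟩
    ∣ a * (b - d) ∣ + ∣ d * (a - c) ∣
      ≤⟨ +-mono-≤ (∣*∣≤ {a} {b - d} 0<B ha hbd) (∣*∣≤ {d} {a - c} 0<C hd hac) ⟩
    ½ * ε + ½ * ε
      ≡⟨ ½+½ ε ⟩
    ε ∎

  product : (∃[ B ] 0ℚ < B × ∃[ K ] ∀ n → K ℕ.≤ n → ∣ x n ∣ ≤ B) →
            (∃[ C ] 0ℚ < C × ∃[ L ] ∀ n → L ℕ.≤ n → ∣ y n ∣ ≤ C) →
            ∃[ N ] ∀ m n → N ℕ.≤ m → N ℕ.≤ n → ∣ x m * y m - x n * y n ∣ ≤ ε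
  product (B , 0<B , K , xb) (C , 0<C , L , yb) =
    (K ℕ.⊔ L) ℕ.⊔ (M ℕ.⊔ N) , λ m n p q →
    let p₁ = ℕₚ.m⊔n≤o⇒m≤o (K ℕ.⊔ L) (M ℕ.⊔ N) p
        p₂ = ℕₚ.m⊔n≤o⇒n≤o (K ℕ.⊔ L) (M ℕ.⊔ N) p
        q₁ = ℕₚ.m⊔n≤o⇒m≤o (K ℕ.⊔ L) (M ℕ.⊔ N) q
        q₂ = ℕₚ.m⊔n≤o⇒n≤o (K ℕ.⊔ L) (M ℕ.⊔ N) q
    in close {a = x m} {y m} {x n} {y n} 0<B 0<C
         (xb m (ℕₚ.m⊔n≤o⇒m≤o K L p₁))
         (proj₂ yc m n (ℕₚ.m⊔n≤o⇒n≤o M N p₂) (ℕₚ.m⊔n≤o⇒n≤o M N q₂))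
         (yb n (ℕₚ.m⊔n≤o⇒n≤o K L q₁))
         (proj₂ xc m n (ℕₚ.m⊔n≤o⇒m≤o M N p₂) (ℕₚ.m⊔n≤o⇒m≤o M N q₂))
    where
    xc = cx (δ 0<C) (1/-scaled-pos 0<C (½-pos 0<ε))
    yc = cy (δ 0<B) (1/-scaled-pos 0<B (½-pos 0<ε))
    M  = proj₁ xc
    N  = proj₁ yc

_*ℝ_ : ℝ → ℝ → ℝ
x *ℝ y = mkℝ (λ n → seq x n * seq y n) (*-cauchy {seq x} {seq y} (cauchy x) (cauchy y))

⊔-close : ∀ {p q r s ε} → p ≤ r + ε → q ≤ s + ε → p ⊔ q ≤ r ⊔ s + ε
⊔-close {p} {q} {r} {s} {ε} h k = ⊔-lub
  (≤-trans h (+-monoˡ-≤ ε (p≤p⊔q r s)))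
  (≤-trans k (+-monoˡ-≤ ε (p≤q⊔p r s)))

⊔-cauchy : ∀ {x y : ℕ → ℚ} → IsCauchy x → IsCauchy y → IsCauchy (λ n → x n ⊔ y n)
⊔-cauchy {x} {y} cx cy ε 0<ε with M , xc ← cx ε 0<ε | N , yc ← cy ε 0<ε
  = M ℕ.⊔ N , λ m n p q →
    ≤⇒∣-∣≤ {x m ⊔ y m} {x n ⊔ y n} {ε} (half m n p q) (half n m q p)
  where
  half : ∀ m n → M ℕ.⊔ N ℕ.≤ m → M ℕ.⊔ N ℕ.≤ n → x m ⊔ y m ≤ x n ⊔ y n + ε
  half m n p q = ⊔-close {x m} {y m} {x n} {y n} {ε}
    (∣-∣≤⇒≤ {x m} {x n} {ε} (xc m n (ℕₚ.m⊔n≤o⇒m≤o M N p) (ℕₚ.m⊔n≤o⇒m≤o M N q)))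
    (∣-∣≤⇒≤ {y m} {y n} {ε} (yc m n (ℕₚ.m⊔n≤o⇒n≤o M N p) (ℕₚ.m⊔n≤o⇒n≤o M N q)))

_⊔ℝ_ : ℝ → ℝ → ℝ
x ⊔ℝ y = mkℝ (λ n → seq x n ⊔ seq y n) (⊔-cauchy {seq x} {seq y} (cauchy x) (cauchy y))

------------------------------------------------------------------------
-- Cube roots, by bisection of [0 , q + 1]

bisectStep : ℚ → ℚ × ℚ → ℚ × ℚ
bisectStep q (l , h) with (½ * (l + h)) ³ ≤? q
... | yes _ = ½ * (l + h) , h
... | no  _ = l , ½ * (l + h)

bisect : ℚ → ℕ → ℚ × ℚ
bisect q zero    = 0ℚ , q + 1ℚ
bisect q (suc n) = bisectStep q (bisect q n)

lower upper : ℚ → ℕ → ℚ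
lower q n = proj₁ (bisect q n)
upper q n = proj₂ (bisect q n)

record Brackets (q : ℚ) (n : ℕ) (b : ℚ × ℚ) : Set where
  constructor brackets
  field
    l-nonNeg : 0ℚ ≤ proj₁ b
    l≤h      : proj₁ b ≤ proj₂ b
    l³≤q     : proj₁ b ³ ≤ q
    q<h³     : q < proj₂ b ³
    h≤q+1    : proj₂ b ≤ q + 1ℚ
    width    : fromℕ (suc n) * (proj₂ b - proj₁ b) ≤ q + 1ℚ

open Brackets public using (l-nonNeg; l≤h; l³≤q; q<h³; h≤q+1; width)

½-split : ∀ {p q} → p ≤ q → p ≤ ½ * (p + q) × ½ * (p + q) ≤ q
½-split {p} {q} p≤q =
  (begin
    p            ≡⟨ solve 1 (λ p → p := con ½ :* (p :+ p)) refl p ⟩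
    ½ * (p + p)  ≤⟨ *-monoˡ-≤-nonNeg ½ (+-monoʳ-≤ p p≤q) ⟩
    ½ * (p + q)  ∎) ,
  (begin
    ½ * (p + q)  ≤⟨ *-monoˡ-≤-nonNeg ½ (+-monoˡ-≤ q p≤q) ⟩
    ½ * (q + q)  ≡⟨ solve 1 (λ q → con ½ :* (q :+ q) := q) refl q ⟩
    q            ∎)
  where open ≤-Reasoning

halve-width : ∀ n {c d} → 0ℚ ≤ d → fromℕ (suc n) * d ≤ c →
  fromℕ (suc (suc n)) * (½ * d) ≤ c
halve-width n {c} {d} 0≤d w = begin
  (1ℚ + (1ℚ + fromℕ n)) * (½ * d)
    ≡⟨ solve 2 (λ k d → (con 1ℚ :+ (con 1ℚ :+ k)) :* (con ½ :* d)
                      := (con 1ℚ :+ con ½ :* k) :* d) refl (fromℕ n) d ⟩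
  (1ℚ + ½ * fromℕ n) * d
    ≤⟨ *-monoʳ-≤-nonNeg d {{nonNegative 0≤d}} (+-monoʳ-≤ 1ℚ ½k≤k) ⟩
  (1ℚ + fromℕ n) * d
    ≤⟨ w ⟩
  c ∎
  where
  open ≤-Reasoning
  ½k≤k : ½ * fromℕ n ≤ fromℕ n
  ½k≤k = ≤-trans
    (*-monoʳ-≤-nonNeg (fromℕ n) {{nonNegative (fromℕ-nonNeg n)}} {½} {1ℚ} ½≤1)
    (≤-reflexive (*-identityˡ (fromℕ n)))
    where
    ½≤1 : ½ ≤ 1ℚ
    ½≤1 = *≤* (ℤ.+≤+ (ℕ.s≤s ℕ.z≤n))

≤⇒0≤- : ∀ {p q} → p ≤ q → 0ℚ ≤ q - p
≤⇒0≤- {p} p≤q = ≤-trans (≤-reflexive (sym (+-inverseʳ p))) (+-monoˡ-≤ (- p) p≤q)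

bisectStep-brackets : ∀ q n b → Brackets q n b → Brackets q (suc n) (bisectStep q b)
bisectStep-brackets q n (l , h) B with (½ * (l + h)) ³ ≤? q
... | yes m³≤q = brackets
  (≤-trans (l-nonNeg B) (proj₁ (½-split (l≤h B)))) (proj₂ (½-split (l≤h B)))
  m³≤q (q<h³ B) (h≤q+1 B)
  (subst (λ d → fromℕ (suc (suc n)) * d ≤ q + 1ℚ)
    (solve 2 (λ l h → con ½ :* (h :- l) := h :- con ½ :* (l :+ h)) refl l h)
    (halve-width n (≤⇒0≤- (l≤h B)) (width B)))
... | no m³≰q = brackets
  (l-nonNeg B) (proj₁ (½-split (l≤h B)))
  (l³≤q B) (≰⇒> m³≰q) (≤-trans (proj₂ (½-split (l≤h B))) (h≤q+1 B))
  (subst (λ d → fromℕ (suc (suc n)) * d ≤ q + 1ℚ)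
    (solve 2 (λ l h → con ½ :* (h :- l) := con ½ :* (l :+ h) :- l) refl l h)
    (halve-width n (≤⇒0≤- (l≤h B)) (width B)))

module _ (q : ℚ) (0≤q : 0ℚ ≤ q) where

  bisect-brackets : ∀ n → Brackets q n (bisect q n)
  bisect-brackets zero = brackets ≤-refl 0≤q+1 0≤q q<[q+1]³ ≤-refl
    (≤-reflexive (solve 1 (λ q → (con 1ℚ :+ con 0ℚ) :* (q :+ con 1ℚ :- con 0ℚ) := q :+ con 1ℚ)
      refl q))
    where
    open ≤-Reasoning
    0≤q+1 : 0ℚ ≤ q + 1ℚ
    0≤q+1 = +-mono-≤ 0≤q (nonNegative⁻¹ 1ℚ)
    q<[q+1]³ : q < (q + 1ℚ) ³
    q<[q+1]³ = begin-strict
      q                                      ≡⟨ +-identityʳ q ⟨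
      q + 0ℚ                                 <⟨ +-monoʳ-< q (positive⁻¹ 1ℚ) ⟩
      q + 1ℚ                                 ≡⟨ +-identityʳ (q + 1ℚ) ⟨
      q + 1ℚ + 0ℚ                            ≤⟨ +-monoʳ-≤ (q + 1ℚ)
                                                  (*-nonNeg 0≤q+1
                                                    (*-nonNeg 0≤q (+-mono-≤ 0≤q+1 (nonNegative⁻¹ 1ℚ)))) ⟩
      q + 1ℚ + (q + 1ℚ) * (q * (q + 1ℚ + 1ℚ))
        ≡⟨ solve 1 (λ q → let s = q :+ con 1ℚ in
             s :+ s :* (q :* (s :+ con 1ℚ)) := s :* s :* s) refl q ⟩
      (q + 1ℚ) ³ ∎
  bisect-brackets (suc n) = bisectStep-brackets q n (bisect q n) (bisect-brackets n)

  lower≤upper : ∀ m n → lower q m ≤ upper q n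
  lower≤upper m n with lower q m ≤? upper q n
  ... | yes l≤u = l≤u
  ... | no  l≰u = contradiction
    (<-≤-trans (q<h³ (bisect-brackets n)) (≤-trans (³-mono-≤ 0≤u (<⇒≤ (≰⇒> l≰u))) (l³≤q (bisect-brackets m))))
    (<-irrefl refl)
    where
    0≤u : 0ℚ ≤ upper q n
    0≤u = ≤-trans (l-nonNeg (bisect-brackets n)) (l≤h (bisect-brackets n))

  width-small : ∀ {ε} → 0ℚ < ε → ∃[ N ] ∀ n → N ℕ.≤ n → upper q n ≤ lower q n + ε
  width-small {ε} 0<ε with N , a ← archimedean (q + 1ℚ) 0<ε = N , λ n N≤n →
    let open ≤-Reasoning
        u-l≤ε : upper q n - lower q n ≤ ε
        u-l≤ε = *-cancelˡ-≤-pos (fromℕ (suc n)) {{positive (fromℕ-pos n)}} (begin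
          fromℕ (suc n) * (upper q n - lower q n) ≤⟨ width (bisect-brackets n) ⟩
          q + 1ℚ                                  ≤⟨ a ⟩
          fromℕ N * ε                             ≤⟨ *-monoʳ-≤-nonNeg ε {{nonNegative (<⇒≤ 0<ε)}}
                                                       (fromℕ-mono (ℕₚ.m≤n⇒m≤1+n N≤n)) ⟩
          fromℕ (suc n) * ε                       ∎)
    in begin
      upper q n                                ≡⟨ solve 2 (λ u l → u := l :+ (u :- l)) refl
                                                    (upper q n) (lower q n) ⟩
      lower q n + (upper q n - lower q n)      ≤⟨ +-monoʳ-≤ (lower q n) u-l≤ε ⟩
      lower q n + ε                            ∎

  lower-cauchy : IsCauchy (lower q)
  lower-cauchy ε 0<ε = proj₁ ws , λ m n N≤m N≤n →
    ≤⇒∣-∣≤ {lower q m} {lower q n} {ε}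
      (≤-trans (lower≤upper m n) (proj₂ ws n N≤n))
      (≤-trans (lower≤upper n m) (proj₂ ws m N≤m))
    where ws = width-small 0<ε

  cbrt : ℝ
  cbrt = mkℝ (lower q) lower-cauchy

  cbrt-nonNeg : 0ℝ ≤ℝ cbrt
  cbrt-nonNeg ε 0<ε = 0 , λ n _ → +-mono-≤ (l-nonNeg (bisect-brackets n)) (<⇒≤ 0<ε)

  cbrt-cubed : cbrt *ℝ cbrt *ℝ cbrt ≃ℝ fromℚ q
  cbrt-cubed = below , above
    where
    open ≤-Reasoning
    below : cbrt *ℝ cbrt *ℝ cbrt ≤ℝ fromℚ q
    below ε 0<ε = 0 , λ n _ → begin
      lower q n ³  ≤⟨ l³≤q (bisect-brackets n) ⟩
      q            ≡⟨ +-identityʳ q ⟨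
      q + 0ℚ       ≤⟨ +-monoʳ-≤ q (<⇒≤ 0<ε) ⟩
      q + ε        ∎

    b C : ℚ
    b = q + 1ℚ
    C = 1ℚ + (b * b + b * b + b * b)
    0≤b : 0ℚ ≤ b
    0≤b = +-mono-≤ 0≤q (nonNegative⁻¹ 1ℚ)
    0≤3b² : 0ℚ ≤ b * b + b * b + b * b
    0≤3b² = +-mono-≤ (+-mono-≤ (*-nonNeg 0≤b 0≤b) (*-nonNeg 0≤b 0≤b)) (*-nonNeg 0≤b 0≤b)
    0<C : 0ℚ < C
    0<C = +-mono-<-≤ (positive⁻¹ 1ℚ) 0≤3b²
    instance _ = >-nonZero 0<C

    step : ∀ ε l h {n} → Brackets q n (l , h) → h ≤ l + 1/ C * ε → q ≤ l ³ + ε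
    step ε l h B h≤l+δ = begin
      q
        ≤⟨ <⇒≤ (q<h³ B) ⟩
      h ³
        ≡⟨ solve 2 (λ l h → h :* h :* h :=
             l :* l :* l :+ (h :* h :+ h :* l :+ l :* l) :* (h :- l)) refl l h ⟩
      l ³ + (h * h + h * l + l * l) * (h - l)
        ≤⟨ +-monoʳ-≤ (l ³) (*-mono-≤-nonNeg 0≤h²+hl+l² (≤-trans 0≤h-l h-l≤δ) h²+hl+l²≤C h-l≤δ) ⟩
      l ³ + C * (1/ C * ε)
        ≡⟨ cong (λ r → l ³ + r) (*-assoc C (1/ C) ε) ⟨
      l ³ + C * 1/ C * ε
        ≡⟨ cong (λ k → l ³ + k * ε) (*-inverseʳ C) ⟩
      l ³ + 1ℚ * ε
        ≡⟨ cong (λ r → l ³ + r) (*-identityˡ ε) ⟩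
      l ³ + ε ∎
      where
      0≤l : 0ℚ ≤ l
      0≤l = l-nonNeg B
      0≤h : 0ℚ ≤ h
      0≤h = ≤-trans 0≤l (l≤h B)
      h≤b : h ≤ b
      h≤b = h≤q+1 B
      l≤b : l ≤ b
      l≤b = ≤-trans (l≤h B) h≤b
      0≤h-l : 0ℚ ≤ h - l
      0≤h-l = ≤⇒0≤- (l≤h B)
      h-l≤δ : h - l ≤ 1/ C * ε
      h-l≤δ = ≤⇒-≤ {h} {l} {1/ C * ε} h≤l+δ
      0≤h²+hl+l² : 0ℚ ≤ h * h + h * l + l * l
      0≤h²+hl+l² = +-mono-≤ (+-mono-≤ (*-nonNeg 0≤h 0≤h) (*-nonNeg 0≤h 0≤l)) (*-nonNeg 0≤l 0≤l)
      h²+hl+l²≤C : h * h + h * l + l * l ≤ C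
      h²+hl+l²≤C = begin
        h * h + h * l + l * l
          ≤⟨ +-mono-≤ (+-mono-≤ (*-mono-≤-nonNeg 0≤h 0≤b h≤b h≤b) (*-mono-≤-nonNeg 0≤h 0≤b h≤b l≤b))
               (*-mono-≤-nonNeg 0≤l 0≤b l≤b l≤b) ⟩
        b * b + b * b + b * b
          ≡⟨ +-identityˡ (b * b + b * b + b * b) ⟨
        0ℚ + (b * b + b * b + b * b)
          ≤⟨ +-monoˡ-≤ (b * b + b * b + b * b) (nonNegative⁻¹ 1ℚ) ⟩
        C ∎

    above : fromℚ q ≤ℝ cbrt *ℝ cbrt *ℝ cbrt
    above ε 0<ε = proj₁ ws , λ n N≤n →
      step ε (lower q n) (upper q n) (bisect-brackets n) (proj₂ ws n N≤n)
      where
      ws = width-small (1/-scaled-pos 0<C 0<ε)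
-- n^{-2/3}, as the cube root of (1/n)².
infix 8 _^-⅔
_^-⅔ : (n : ℕ) .{{_ : ℕ.NonZero n}} → ℝ
n ^-⅔ = cbrt (1/n * 1/n) (*-nonNeg 0≤1/n 0≤1/n)
  where
  1/n = + 1 / n
  0≤1/n : 0ℚ ≤ 1/n
  0≤1/n = nonNegative⁻¹ 1/n {{normalize-nonNeg 1 n}}

¼ℝ : ℝ
¼ℝ = fromℚ (+ 1 / 4)

-- 1 / (8 · 3^{2/3}) = (1/8) · 3^{-2/3}
k₂ : ℝ
k₂ = fromℚ (+ 1 / 8) *ℝ 3 ^-⅔

------------------------------------------------------------------------
-- Suprema.  The supremum of a set of reals is taken in the lower reals: it is
-- given by the set of rationals strictly below it.  Every set of reals has a
-- supremum of this kind; +∞ is the case where all rationals are below.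

record LowerReal : Set₁ where
  field
    below      : ℚ → Set
    downClosed : ∀ {q r} → q ≤ r → below r → below q
    rounded    : ∀ {q} → below q → ∃[ r ] q < r × below r

open LowerReal public

-- x ≤ sup S iff every rational q < x has q < sup S.
infix  4 _≤ᴸ_
_≤ᴸ_ : ℝ → LowerReal → Set
x ≤ᴸ a = ∀ q → fromℚ q <ℝ x → below a q

sup : (ℝ → Set) → LowerReal
sup S .below q = ∃[ c ] S c × fromℚ q <ℝ c
sup S .downClosed q≤r (c , c∈S , ε , 0<ε , N , lt) =
  c , c∈S , ε , 0<ε , N , λ n N≤n → ≤-trans (+-monoˡ-≤ ε q≤r) (lt n N≤n)
sup S .rounded {q} (c , c∈S , ε , 0<ε , N , lt) =
  q + ½ * ε ,
  (let open ≤-Reasoning in begin-strict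
     q           ≡⟨ +-identityʳ q ⟨
     q + 0ℚ      <⟨ +-monoʳ-< q (½-pos 0<ε) ⟩
     q + ½ * ε   ∎) ,
  c , c∈S , ½ * ε , ½-pos 0<ε , N , λ n N≤n → ≤-trans
    (≤-reflexive (trans (+-assoc q (½ * ε) (½ * ε)) (cong (λ r → q + r) (½+½ ε))))
    (lt n N≤n)

sup-upperBound : ∀ (S : ℝ → Set) {c} → S c → c ≤ᴸ sup S
sup-upperBound S {c} c∈S q q<c = c , c∈S , q<c

sup-least : ∀ (S : ℝ → Set) {y} → (∀ c → S c → c ≤ℝ y) →
  ∀ q → below (sup S) q → fromℚ q <ℝ y
sup-least S {y} ub q (c , c∈S , ε , 0<ε , M , lt)
  with N , c≤y ← ub c c∈S (½ * ε) (½-pos 0<ε)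
  = ½ * ε , ½-pos 0<ε , M ℕ.⊔ N , λ n p →
    let open ≤-Reasoning in begin
      q + ½ * ε              ≡⟨ solve 2 (λ q ε → q :+ con ½ :* ε := q :+ ε :- con ½ :* ε) refl q ε ⟩
      q + ε - ½ * ε          ≤⟨ ≤⇒-≤ (≤-trans (lt n (ℕₚ.m⊔n≤o⇒m≤o M N p))
                                   (≤-trans (c≤y n (ℕₚ.m⊔n≤o⇒n≤o M N p))
                                     (≤-reflexive (+-comm (seq y n) (½ * ε))))) ⟩
      seq y n                ∎

------------------------------------------------------------------------
-- Weighted digraphs

-- The arc set is a Boolean relation, so that there is at most one arc from u
-- to v, and a weight is attached to actual arcs only.
record WeightedDigraph : Set where
  field
    order    : ℕ
    arc      : Fin order → Fin order → Bool

  Vertex : Set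
  Vertex = Fin order

  Arc : Vertex → Vertex → Set
  Arc u v = T (arc u v)

  field
    loopless : ∀ v → ¬ Arc v v
    weight   : ∀ {u v} → Arc u v → ℝ
    weight≥0 : ∀ {u v} (a : Arc u v) → 0ℝ ≤ℝ weight a

  arc? : ∀ u v → Dec (Arc u v)
  arc? u v = T? (arc u v)

∑ : ∀ {n} → (Fin n → ℝ) → ℝ
∑ = foldr _+ℝ_ 0ℝ

⨆ : ∀ {n} → (Subset n → ℝ) → ℝ
⨆ {zero}  f = f []
⨆ {suc n} f = ⨆ (λ X → f (outside ∷ X)) ⊔ℝ ⨆ (λ X → f (inside ∷ X))

module _ (D : WeightedDigraph) where
  open WeightedDigraph D

  weightOf : ∀ {u v} → Dec (Arc u v) → ℝ
  weightOf (yes a) = weight a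
  weightOf (no  _) = 0ℝ

  totalWeight : ℝ
  totalWeight = ∑ λ u → ∑ λ v → weightOf (arc? u v)

  -- w(X , Y) for the partition with Y = V ∖ X; X and Y may be empty.
  cutWeight : Subset order → ℝ
  cutWeight X = ∑ λ u → ∑ λ v →
    if does (u ∈? X ×-dec ¬? (v ∈? X)) then weightOf (arc? u v) else 0ℝ

  mac : ℝ
  mac = ⨆ cutWeight

  IsDirectedPath : List Vertex → Set
  IsDirectedPath vs = Unique vs × Linked Arc vs

  -- the directed cycle  v → v₁ → ⋯ → vₖ → v
  IsDirectedCycle : Vertex → List Vertex → Set
  IsDirectedCycle v vs = Unique (v ∷ vs) × Linked Arc (v ∷ (vs ∷ʳ v))

  Acyclic : Set
  Acyclic = ∀ v vs → ¬ IsDirectedCycle v vs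

  LongestPathHasOrder : ℕ → Set
  LongestPathHasOrder ν =
    (∃[ vs ] IsDirectedPath vs × length vs ≡ ν) ×
    (∀ vs → IsDirectedPath vs → length vs ℕ.≤ ν)

-- c₁ = +∞, as the digraphs concerned have no arcs.
c : ℕ → LowerReal
c ν = sup λ x → 0ℝ ≤ℝ x ×
  (∀ D → Acyclic D → LongestPathHasOrder D ν → x *ℝ totalWeight D ≤ℝ mac D)

-- Sort the vertices into layers by the longest path starting at them, so that arcs go from higher
-- to lower layers and only the ν layers matter: it suffices to find a random set of layers which,
-- for any i > j, contains i but not j with probability at least 1/4 + k₂ ν^(-2/3), because the
-- expected weight of the resulting cut is then large enough.  Group the layers into 2D + 1 blocks
-- of 2h and draw, independently, a uniformly random set of h + d layers from the block number
-- d = -D, …, D.  Drawing without replacement gains a factor 2h / (2h - 1) inside a block, and the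
-- growth of d gains about 1 / (4h) between blocks, against a loss of about (d / 2h)².  Every pair
-- is separated with probability at least
--   (h + D) (h - D) / (2h (2h - 1)) = 1/4 + (h - 2D²) / (4h (2h - 1)),
-- and h of the order of D² = Θ(ν^(2/3)) gives the claim, the constants leaving room for rounding.

module Submission where

open import Data.Bool.Base using (Bool; true; false; not; _∧_; if_then_else_)
open import Data.Fin.Base using (Fin; zero; suc)
import Data.Fin.Properties as Fin using (_≟_; any?)
open import Data.Fin.Subset using (Subset)
import Data.Fin.Subset.Properties as Subset using (_∈?_)
import Data.Integer.Base as ℤ using (+_)
open import Data.Nat.Base as ℕ using (ℕ; zero; suc; NonZero)
import Data.Nat.DivMod as ℕ using (_/_; _%_; /-monoˡ-≤; m%n<n; m<n*o⇒m/o<n; m≡m%n+[m/n]*n)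
import Data.Nat.Properties as ℕₚ using (*-comm; *-distribˡ-+; *-monoʳ-≤; *-monoˡ-≤; *-suc;
  +-cancelʳ-≡; +-identityʳ; +-monoʳ-≤; +-monoˡ-≤; +-suc; <-cmp; <-trans; <-≤-trans; <⇒≢; <⇒≤;
  m*n≢0; m+[n∸m]≡n; m≤m*n; m≤m+n; m≤n+m; m⊔n≤o⇒m≤o; m⊔n≤o⇒n≤o; n≤1+n; suc-pred; ∸-monoʳ-<;
  ≤-<-trans; ≤-reflexive; ≤-trans; ≤⇒≯; module ≤-Reasoning)
open import Data.Nat.Solver using () renaming (module +-*-Solver to ℕSolver)
open import Data.Product.Base using (_,_; proj₁; proj₂; ∃-syntax; _×_)
open import Data.Rational.Solver using () renaming (module +-*-Solver to ℚSolver)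
import Data.Rational.Unnormalised.Base as ℚᵘ using (_*_; *≡*; 1ℚᵘ; mkℚᵘ)
import Data.Rational.Unnormalised.Properties as ℚᵘₚ using (*-cong; module ≃-Reasoning)
open import Function.Base using (_∘_)
open import Relation.Binary.Definitions using (tri<; tri≈; tri>)
open import Relation.Binary.PropositionalEquality hiding ([_])
open import Relation.Nullary using (Dec; does; yes; no; contradiction)
open import Relation.Nullary.Decidable using (_×-dec_; ¬?)

open import Defs

-- Walks and layers in acyclic digraphs.

module Paths where

  open import Data.List.Base using (List; []; _∷_; _++_; _∷ʳ_; length)
  open import Data.List.Membership.DecPropositional using (_∈?_)
  open import Data.List.Membership.Propositional.Properties using (∈-∃++)
  open import Data.List.Relation.Unary.All.Properties using (¬Any⇒All¬; ++⁻ˡ; ++⁻ʳ)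
  open import Data.List.Relation.Unary.All using ([]; _∷_)
  open import Data.List.Relation.Unary.AllPairs using ([]; _∷_)
  open import Data.List.Relation.Unary.Linked using (Linked; [-]; _∷_)
  open import Data.List.Relation.Unary.Unique.Propositional using (Unique)
  open import Data.Sum.Base using (inj₁; inj₂)
  open import Data.Unit.Base using (⊤; tt)
  open import Relation.Unary using (Decidable)
  open import Data.Nat.Base using (_≤_; _<_; z≤n; s≤s)
  open import Data.Nat.Properties using (≤-refl; <⇒≤; m≤n⇒m≤1+n; m<1+n⇒m<n∨m≡n)

  module _ {A : Set} {R : A → A → Set} where

    Linked-prefix : ∀ u as {v bs} → Linked R (u ∷ as ++ v ∷ bs) → Linked R (u ∷ (as ∷ʳ v))
    Linked-prefix u []       (r ∷ _)  = r ∷ [-]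
    Linked-prefix u (a ∷ as) (r ∷ rs) = r ∷ Linked-prefix a as rs

  Unique-prefix : ∀ {A : Set} (as : List A) {v bs} → Unique (as ++ v ∷ bs) → Unique (v ∷ as)
  Unique-prefix []       _              = [] ∷ []
  Unique-prefix (a ∷ as) (a∉ ∷ u) with v∉as ∷ uas ← Unique-prefix as u with a≢v ∷ _ ← ++⁻ʳ as a∉ =
    ((a≢v ∘ sym) ∷ v∉as) ∷ (++⁻ˡ as a∉ ∷ uas)

  largest : ∀ {P : ℕ → Set} → Decidable P → P 0 → ∀ n →
    ∃[ m ] m ≤ n × P m × (∀ j → j ≤ n → P j → j ≤ m)
  largest P? p₀ zero = 0 , z≤n , p₀ , λ _ j≤0 _ → j≤0
  largest P? p₀ (suc n) with P? (suc n) | largest P? p₀ n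
  ... | yes p | _ = suc n , ≤-refl , p , λ _ j≤ _ → j≤
  ... | no ¬p | m , m≤n , pm , max = m , m≤n⇒m≤1+n m≤n , pm , λ j j≤ pj → max′ j (m<1+n⇒m<n∨m≡n (s≤s j≤)) pj
    where
    max′ : ∀ j → _ → _ → j ≤ m
    max′ j (inj₁ (s≤s j≤n)) pj = max j j≤n pj
    max′ j (inj₂ refl)      pj = contradiction pj ¬p

  module _ (D : WeightedDigraph) where
    open WeightedDigraph D

    -- If the head `v` recurs in the tail, the stretch up to that recurrence closes to a directed
    -- cycle; its vertices are distinct because the tail is repetition-free, by recursion.
    linked⇒unique : Acyclic D → ∀ vs → Linked Arc vs → Unique vs
    linked⇒unique acyclic []       _ = []
    linked⇒unique acyclic (v ∷ []) _ = [] ∷ []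
    linked⇒unique acyclic (v ∷ vs@(_ ∷ _)) vvs@(_ ∷ l) with _∈?_ Fin._≟_ v vs
    ... | no  v∉vs = ¬Any⇒All¬ vs v∉vs ∷ linked⇒unique acyclic vs l
    ... | yes v∈vs with as , bs , eq ← ∈-∃++ v∈vs = contradiction
      ( Unique-prefix as (subst Unique eq (linked⇒unique acyclic vs l))
      , Linked-prefix v as (subst (λ us → Linked Arc (v ∷ us)) eq vvs))
      (acyclic v as)

    -- The index counts arcs, one less than vertices. Distinctness is not demanded, so that walks
    -- can be decided by searching for the next vertex; acyclicity supplies it through
    -- `linked⇒unique`.
    Walk : ℕ → Vertex → Set
    Walk zero    v = ⊤
    Walk (suc n) v = ∃[ u ] Arc v u × Walk n u

    walk? : ∀ n v → Dec (Walk n v)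
    walk? zero    v = yes tt
    walk? (suc n) v = Fin.any? λ u → arc? v u ×-dec walk? n u

    walkList : ∀ n v → Walk n v → ∃[ vs ] Linked Arc (v ∷ vs) × length vs ≡ n
    walkList zero    v _ = [] , [-] , refl
    walkList (suc n) v (u , a , w) with vs , l , eq ← walkList n u w = u ∷ vs , a ∷ l , cong suc eq

    -- The layer of `v` is the number of arcs on a longest walk from `v`. The search stops at `ν`,
    -- which loses nothing: walks are paths here, so they have fewer than `ν` arcs.
    layering : Acyclic D → ∀ ν → LongestPathHasOrder D ν →
      ∃[ ℓ ] (∀ v → ℓ v < ν) × (∀ {u v} → Arc u v → ℓ v < ℓ u)
    layering acyclic ν (_ , longest) = ℓ , (λ v → short v (walk v)) ,
      -- Prepending the arc to a longest walk from `v` gives a walk from `u` with `suc (ℓ v)` arcs,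
      -- so `ℓ u` is at least that.
      λ {u} {v} a → let w = v , a , walk v in
        proj₂ (proj₂ (proj₂ (top u))) _ (<⇒≤ (short u w)) w
      where
      top : ∀ v → _
      top v = largest (λ n → walk? n v) tt ν
      ℓ : Vertex → ℕ
      ℓ v = proj₁ (top v)
      walk : ∀ v → Walk (ℓ v) v
      walk v = proj₁ (proj₂ (proj₂ (top v)))
      short : ∀ {n} v → Walk n v → n < ν
      short {n} v w with vs , l , refl ← walkList n v w = longest (v ∷ vs) (linked⇒unique acyclic _ l , l)

-- Choice of the number and the size of the blocks.

module Scales where

  open import Data.Nat.Base using (_+_; _*_; _∸_; _≤_; _<_; z≤n; s≤s; >-nonZero)
  open import Data.Nat.DivMod using (_/_; /-monoˡ-≤; m%n<n; m*n/n≡m; m/n*n≤m; m<n*o⇒m/o<n;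
    m≡m%n+[m/n]*n)
  open import Data.Nat.Properties using (*-comm; *-mono-≤; *-monoʳ-≤; *-monoˡ-≤; *-suc;
    +-cancelʳ-≤; +-identityʳ; +-monoʳ-≤; +-monoˡ-<; +-monoˡ-≤; m+[n∸m]≡n; m<n⇒0<n∸m; m∸n+n≡m;
    m∸n≤m; m≤m*n; m≤m+n; m≤n*m; m≤n+m; m≤n+m∸n; m≤n⇒m≤1+n; n<1+n; n≤1+n; ∸-monoˡ-≤; ≤-refl;
    ≤-reflexive; ≤-trans; ≮⇒≥; _<?_; module ≤-Reasoning)
  open ℕSolver using (solve; _:+_; _:*_; _:=_; con)

  cube : ℕ → ℕ
  cube n = n * n * n

  square-mono : ∀ {m n} → m ≤ n → m * m ≤ n * n
  square-mono m≤n = *-mono-≤ m≤n m≤n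

  -- There are 2D + 1 blocks of 2h layers. Storing e = h - D and k = h - 2D² avoids truncated
  -- subtraction; k is the numerator of the gain over 1/4.
  record Scale (ν : ℕ) : Set where
    field
      e D k : ℕ
    h : ℕ
    h = e + D
    field
      0<e    : 0 < e
      covers : ν ≤ suc (2 * D) * (e + (e + 2 * D))
      k+2D²  : k + 2 * (D * D) ≡ h
      -- k / (8h²) ≥ k₂ ν^(-2/3), cubed
      enough : cube (h * h) ≤ 9 * (ν * ν) * cube k

  -- 18 y³ = (1 + y)⁴ + (y - 1) (13 - y) y² + 7 y² - 4 y - 1, where y = k / a ∈ [1, 13]
  -- and k = a + p.
  quartic≤cubic : ∀ a p → a + p ≤ 13 * a →
    (a + p + a) * (a + p + a) * ((a + p + a) * (a + p + a)) ≤ 18 * a * cube (a + p)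
  quartic≤cubic a p k≤13a = +-cancelʳ-≤ (p * cube k) _ _ (begin
    -- The term (y - 1) (13 - y) y², times a⁴, is p (13a - k) k²; its negative part stands on the
    -- left as `p * cube k`. `R` is a⁴ (7y² - 4y - 1), which has nonnegative coefficients in `a` and
    -- `p`.
    Q + p * (k * k * k)                      ≤⟨ +-monoʳ-≤ Q (*-monoʳ-≤ p (*-monoʳ-≤ (k * k) k≤13a)) ⟩
    Q + p * (k * k * (13 * a))               ≤⟨ m≤m+n _ R ⟩
    Q + p * (k * k * (13 * a)) + R
      ≡⟨ solve 2 (λ a p → let k = a :+ p; s = (k :+ a) :* (k :+ a) in
           s :* s :+ p :* (k :* k :* (con 13 :* a))
             :+ a :* a :* (con 2 :* (a :* a) :+ con 10 :* (a :* p) :+ con 7 :* (p :* p))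
           := con 18 :* a :* (k :* k :* k) :+ p :* (k :* k :* k)) refl a p ⟩
    18 * a * cube k + p * cube k             ∎)
    where
    open ≤-Reasoning
    k = a + p
    Q = (k + a) * (k + a) * ((k + a) * (k + a))
    R = a * a * (2 * (a * a) + 10 * (a * p) + 7 * (p * p))

  -- The number D serves the half block sizes h from 4 D² (from 1, if D = 0) up to maxHalf D.
  maxHalf : ℕ → ℕ
  maxHalf zero      = 9
  maxHalf D@(suc _) = 28 * (D * D)

  -- With ν = n + 1, `h` is the ceiling of ν / (2V), the least half block size that covers all
  -- layers. Rounding up still leaves V h ≤ ν, so multiplying the quartic bound, which is free of ν,
  -- by h² gives `enough`.
  fromBounds : ∀ n D q k → let V = suc (2 * D); h = suc q in
    q * (2 * V) ≤ n → n < h * (2 * V) → k + 2 * (D * D) ≡ h → D ≤ q →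
    V * h ≤ suc (2 * V * q) → h * h * (h * h) ≤ 9 * (V * V) * cube k → Scale (suc n)
  fromBounds n D q k lo hi k+2D² D≤q V≤ quartic = record
    { e = h ∸ D ; D = D ; k = k
    ; 0<e = m<n⇒0<n∸m (s≤s D≤q)
    ; covers = subst (suc n ≤_) (trans
        (solve 2 (λ x v → x :* (con 2 :* v) := v :* (con 2 :* x)) refl h V)
        (cong (V *_) (trans (cong (2 *_) (sym e+D≡h))
          (solve 2 (λ e d → con 2 :* (e :+ d) := e :+ (e :+ con 2 :* d)) refl (h ∸ D) D)))) hi
    ; k+2D² = trans k+2D² (sym e+D≡h)
    ; enough = subst (λ h → cube (h * h) ≤ 9 * (suc n * suc n) * cube k) (sym e+D≡h) (begin
        h * h * (h * h) * (h * h)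
          ≤⟨ *-monoˡ-≤ (h * h) quartic ⟩
        9 * (V * V) * cube k * (h * h)
          ≡⟨ solve 3 (λ v c h → con 9 :* (v :* v) :* c :* (h :* h) := con 9 :* (v :* h :* (v :* h)) :* c) refl V (cube k) h ⟩
        9 * (V * h * (V * h)) * cube k
          ≤⟨ *-monoˡ-≤ (cube k) (*-monoʳ-≤ 9 (square-mono Vh≤ν)) ⟩
        9 * (suc n * suc n) * cube k ∎)
    }
    where
    open ≤-Reasoning
    h = suc q
    V = suc (2 * D)
    e+D≡h : h ∸ D + D ≡ h
    e+D≡h = m∸n+n≡m (m≤n⇒m≤1+n D≤q)
    Vh≤ν : V * h ≤ suc n
    Vh≤ν = ≤-trans V≤ (s≤s (≤-trans (≤-reflexive (*-comm (2 * V) q)) lo))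

  -- `D` is lowered until the bound fails for its predecessor. Then `gap` gives h ≥ 4D², while the
  -- bound for `D` gives h ≤ 28D². With a = 2D² and k = h - a this says a ≤ k ≤ 13a, the range of
  -- `quartic≤cubic`.
  scale-below : ∀ n D → n < maxHalf D * (2 * suc (2 * D)) → Scale (suc n)
  scale-below n zero n<18 = fromBounds n 0 (n / 2) h (m/n*n≤m n 2) n<hW
    (+-identityʳ h) z≤n
    (≤-trans (≤-reflexive (+-identityʳ h)) (s≤s (m≤m+n (n / 2) (n / 2 + 0))))
    -- A single block has V = 1 and k = h, so the quartic bound is h⁴ ≤ 9h³; hence the value 9 of
    -- `maxHalf` at 0.
    (begin
      h * h * (h * h)     ≡⟨ solve 1 (λ h → h :* h :* (h :* h) := h :* (h :* h :* h)) refl h ⟩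
      h * cube h          ≤⟨ *-monoˡ-≤ (cube h) (m<n*o⇒m/o<n {n = 9} n<18) ⟩
      9 * cube h          ∎)
    where
    open ≤-Reasoning
    h = suc (n / 2)
    n<hW : n < suc (n / 2) * 2
    n<hW = subst (_< suc (n / 2) * 2) (sym (m≡m%n+[m/n]*n n 2)) (+-monoˡ-< (n / 2 * 2) (m%n<n n 2))
  scale-below n (suc d) n<U with n <? maxHalf d * (2 * suc (2 * d))
  ... | yes n<U′ = scale-below n d n<U′
  ... | no  n≮U′ = fromBounds n D q (a + p) (m/n*n≤m n W) n<hW
    k+a≡h (≤-trans (n≤1+n D) (≤-trans 1+D≤3D (≤-trans 3D≤4D²-1 4D²-1≤q)))
    (begin
      V * suc q         ≡⟨ *-suc V q ⟩
      V + V * q         ≤⟨ +-monoˡ-≤ (V * q) (m≤m*n V q {{>-nonZero 0<q}}) ⟩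
      V * q + V * q     ≡⟨ solve 2 (λ v q → v :* q :+ v :* q := con 2 :* v :* q) refl V q ⟩
      2 * V * q         ≤⟨ n≤1+n _ ⟩
      suc (2 * V * q)   ∎)
    -- First h⁴ ≤ 18 a k³, then 18 a = (6D)² ≤ 9V², as V > 2D.
    (subst (λ h → h * h * (h * h) ≤ 9 * (V * V) * cube (a + p)) k+a≡h (≤-trans
      (quartic≤cubic a p (+-cancelʳ-≤ a _ _ (begin
        a + p + a         ≡⟨ k+a≡h ⟩
        suc q             ≤⟨ m<n*o⇒m/o<n n<U ⟩
        28 * (D * D)      ≡⟨ solve 1 (λ x → con 28 :* x := con 13 :* (con 2 :* x) :+ con 2 :* x) refl (D * D) ⟩
        13 * a + a        ∎)))
      (*-monoˡ-≤ (cube (a + p)) (begin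
        18 * (2 * (D * D))              ≤⟨ m≤m+n _ (36 * D + 9) ⟩
        18 * (2 * (D * D)) + (36 * D + 9)
          ≡⟨ solve 1 (λ d → con 18 :* (con 2 :* (d :* d)) :+ (con 36 :* d :+ con 9)
               := con 9 :* ((con 1 :+ con 2 :* d) :* (con 1 :+ con 2 :* d))) refl D ⟩
        9 * (V * V) ∎))))
    where
    open ≤-Reasoning
    D = suc d
    V = suc (2 * D)
    W = 2 * V
    q = n / W
    a = 2 * (D * D)
    4D²-1 = 4 * (D * D) ∸ 1
    n<hW : n < suc q * W
    n<hW = subst (_< suc q * W) (sym (m≡m%n+[m/n]*n n W)) (+-monoˡ-< (q * W) (m%n<n n W))
    gap : ∀ d → (4 * (suc d * suc d) ∸ 1) * (2 * suc (2 * suc d)) ≤ maxHalf d * (2 * suc (2 * d))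
    -- Equality, 3 · 6 = 9 · 2: at D = 1 the two ranges only just meet, and the subtracted 1 is
    -- essential. For larger D it is given away.
    gap zero = ≤-refl
    gap (suc c) = ≤-trans (*-monoˡ-≤ (2 * suc (2 * suc (suc c))) (m∸n≤m (4 * (suc (suc c) * suc (suc c))) 1)) (begin
      4 * (suc (suc c) * suc (suc c)) * (2 * suc (2 * suc (suc c)))
        ≤⟨ m≤m+n _ (8 + 224 * c + 288 * (c * c) + 96 * (c * c * c)) ⟩
      _ ≡⟨ solve 1 (λ c → let x = con 1 :+ (con 1 :+ c); y = con 1 :+ c in
             con 4 :* (x :* x) :* (con 2 :* (con 1 :+ con 2 :* x)) :+ (con 8 :+ con 224 :* c :+ con 288 :* (c :* c) :+ con 96 :* (c :* c :* c))
             := con 28 :* (y :* y) :* (con 2 :* (con 1 :+ con 2 :* y))) refl c ⟩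
      28 * (suc c * suc c) * (2 * suc (2 * suc c)) ∎)
    4D²-1≤q : 4D²-1 ≤ q
    4D²-1≤q = subst (_≤ q) (m*n/n≡m 4D²-1 W) (/-monoˡ-≤ W (≤-trans (gap d) (≮⇒≥ n≮U′)))
    1+D≤3D : suc D ≤ 3 * D
    1+D≤3D = s≤s (≤-trans (m≤n+m D d) (+-monoʳ-≤ d (m≤m+n D (D + 0))))
    3D≤4D²-1 : 3 * D ≤ 4D²-1
    3D≤4D²-1 = ∸-monoˡ-≤ {1 + 3 * D} {4 * (D * D)} 1 (subst (1 + 3 * D ≤_)
      (solve 1 (λ d → con 1 :+ con 3 :* (con 1 :+ d) :+ (con 5 :* d :+ con 4 :* (d :* d)) := con 4 :* ((con 1 :+ d) :* (con 1 :+ d))) refl d)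
      (m≤m+n (1 + 3 * D) (5 * d + 4 * (d * d))))
    0<q : 0 < q
    0<q = ≤-trans (≤-trans (s≤s z≤n) (≤-trans 1+D≤3D 3D≤4D²-1)) 4D²-1≤q
    p = suc q ∸ 4 * (D * D)
    k+a≡h : a + p + a ≡ suc q
    k+a≡h = trans (solve 2 (λ x p → con 2 :* x :+ p :+ con 2 :* x := con 4 :* x :+ p) refl (D * D) p)
      (m+[n∸m]≡n (≤-trans (m≤n+m∸n (4 * (D * D)) 1) (s≤s 4D²-1≤q)))

  scale : ∀ ν .{{_ : NonZero ν}} → Scale ν
  -- The start D = ν is generous; the descent corrects it.
  scale (suc n) = scale-below n (suc n) (begin-strict
    n                   <⟨ n<1+n n ⟩
    suc n               ≤⟨ m≤m*n (suc n) (suc n) ⟩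
    suc n * suc n       ≤⟨ m≤n*m (suc n * suc n) 28 ⟩
    28 * (suc n * suc n) ≤⟨ m≤m*n _ (2 * suc (2 * suc n)) ⟩
    28 * (suc n * suc n) * (2 * suc (2 * suc n)) ∎)
    where open ≤-Reasoning

open Paths
open Scales

open import Data.Rational.Base using (ℚ; 0ℚ; 1ℚ; ½; _+_; _*_; _-_; _/_; 1/_; _≤_; _<_; Positive;
  positive; nonNegative; >-nonZero; toℚᵘ)
open import Data.Rational.Properties using (*-assoc; *-cancelʳ-≤-pos; *-cancelˡ-≤-pos; *-comm;
  *-distribʳ-+; *-distribˡ-+; *-identityʳ; *-identityˡ; *-inverseʳ; *-inverseˡ; *-monoʳ-<-pos;
  *-monoʳ-≤-nonNeg; *-monoˡ-≤-nonNeg; *-zeroʳ; *-zeroˡ; +-assoc; +-identityʳ; +-identityˡ;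
  +-mono-≤; +-monoʳ-≤; +-monoˡ-≤; 1/pos⇒pos; <-irrefl; <⇒≤; nonNegative⁻¹; normalize-nonNeg;
  p≤p⊔q; p≤q⊔p; pos*pos⇒pos; positive⁻¹; toℚᵘ-fromℚᵘ; toℚᵘ-homo-*; toℚᵘ-injective; ≤-<-trans;
  ≤-antisym; ≤-refl; ≤-reflexive; ≤-trans; ≰⇒>; _≤?_; module ≤-Reasoning)

open ℕSolver using () renaming (solve to solveℕ; _:=_ to _⊜_; _:+_ to _⊕_; _:*_ to _⊗_; con to conℕ)
open ℚSolver using (solve; _:+_; _:*_; _:-_; _:=_; con)

-- Natural numbers as rationals.

fromℕ-+ : ∀ m n → fromℕ (m ℕ.+ n) ≡ fromℕ m + fromℕ n
fromℕ-+ zero    n = sym (+-identityˡ (fromℕ n))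
fromℕ-+ (suc m) n = trans (cong (λ x → 1ℚ + x) (fromℕ-+ m n)) (sym (+-assoc 1ℚ (fromℕ m) (fromℕ n)))

fromℕ-* : ∀ m n → fromℕ (m ℕ.* n) ≡ fromℕ m * fromℕ n
fromℕ-* zero    n = sym (*-zeroˡ (fromℕ n))
fromℕ-* (suc m) n = begin
  fromℕ (n ℕ.+ m ℕ.* n)          ≡⟨ fromℕ-+ n (m ℕ.* n) ⟩
  fromℕ n + fromℕ (m ℕ.* n)      ≡⟨ cong (λ x → fromℕ n + x) (fromℕ-* m n) ⟩
  fromℕ n + fromℕ m * fromℕ n    ≡⟨ solve 2 (λ x y → y :+ x :* y := (con 1ℚ :+ x) :* y) refl (fromℕ m) (fromℕ n) ⟩
  (1ℚ + fromℕ m) * fromℕ n       ∎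
  where open ≡-Reasoning

1/suc : ℕ → ℚ
1/suc n = (1/ fromℕ (suc n)) {{>-nonZero (fromℕ-pos n)}}

suc*1/suc : ∀ n → fromℕ (suc n) * 1/suc n ≡ 1ℚ
suc*1/suc n = *-inverseʳ (fromℕ (suc n)) {{>-nonZero (fromℕ-pos n)}}

1/suc≥0 : ∀ n → 0ℚ ≤ 1/suc n
1/suc≥0 n = <⇒≤ (positive⁻¹ (1/suc n) {{1/pos⇒pos (fromℕ (suc n)) {{positive (fromℕ-pos n)}}}})

*-cancel-pos-≡ : ∀ r {p q} → 0ℚ < r → r * p ≡ r * q → p ≡ q
*-cancel-pos-≡ r 0<r eq = ≤-antisym (half eq) (half (sym eq))
  where
  half : ∀ {p q} → r * p ≡ r * q → p ≤ q
  half eq = *-cancelˡ-≤-pos r {{positive 0<r}} (≤-reflexive eq)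

0<fromℕ : ∀ {n} → 0 ℕ.< n → 0ℚ < fromℕ n
0<fromℕ {suc n} _ = fromℕ-pos n

-- Finitely supported probability distributions

data Dist (A : Set) : Set where
  return : A → Dist A
  mix    : ∀ {p q} → 0ℚ ≤ p → 0ℚ ≤ q → p + q ≡ 1ℚ → Dist A → Dist A → Dist A

private variable
  A B : Set

𝔼 : Dist A → (A → ℚ) → ℚ
𝔼 (return a)                f = f a
𝔼 (mix {p} {q} _ _ _ d₁ d₂) f = p * 𝔼 d₁ f + q * 𝔼 d₂ f

infixl 1 _>>=_
_>>=_ : Dist A → (A → Dist B) → Dist B
return a            >>= k = k a
mix 0≤p 0≤q e d₁ d₂ >>= k = mix 0≤p 0≤q e (d₁ >>= k) (d₂ >>= k)

infixl 4 _<$>_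
_<$>_ : (A → B) → Dist A → Dist B
g <$> d = d >>= return ∘ g

𝔼-cong : ∀ (d : Dist A) {f g : A → ℚ} → (∀ a → f a ≡ g a) → 𝔼 d f ≡ 𝔼 d g
𝔼-cong (return a)        f≡g = f≡g a
𝔼-cong (mix {p} {q} _ _ _ d₁ d₂) f≡g = cong₂ (λ x y → p * x + q * y) (𝔼-cong d₁ f≡g) (𝔼-cong d₂ f≡g)

𝔼-mono : ∀ (d : Dist A) {f g : A → ℚ} → (∀ a → f a ≤ g a) → 𝔼 d f ≤ 𝔼 d g
𝔼-mono (return a) f≤g = f≤g a
𝔼-mono (mix {p} {q} 0≤p 0≤q _ d₁ d₂) f≤g = +-mono-≤
  (*-monoˡ-≤-nonNeg p {{nonNegative 0≤p}} (𝔼-mono d₁ f≤g))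
  (*-monoˡ-≤-nonNeg q {{nonNegative 0≤q}} (𝔼-mono d₂ f≤g))

𝔼-const : ∀ (d : Dist A) r → 𝔼 d (λ _ → r) ≡ r
𝔼-const (return a) r = refl
𝔼-const (mix {p} {q} _ _ p+q≡1 d₁ d₂) r = begin
  p * 𝔼 d₁ (λ _ → r) + q * 𝔼 d₂ (λ _ → r)  ≡⟨ cong₂ (λ x y → p * x + q * y) (𝔼-const d₁ r) (𝔼-const d₂ r) ⟩
  p * r + q * r                            ≡⟨ *-distribʳ-+ r p q ⟨
  (p + q) * r                              ≡⟨ cong (_* r) p+q≡1 ⟩
  1ℚ * r                                   ≡⟨ *-identityˡ r ⟩
  r                                        ∎
  where open ≡-Reasoning

𝔼-+ : ∀ (d : Dist A) (f g : A → ℚ) → 𝔼 d (λ a → f a + g a) ≡ 𝔼 d f + 𝔼 d g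
𝔼-+ (return a) f g = refl
𝔼-+ (mix {p} {q} _ _ _ d₁ d₂) f g = trans
  (cong₂ (λ x y → p * x + q * y) (𝔼-+ d₁ f g) (𝔼-+ d₂ f g))
  (solve 6 (λ p q a b c d → p :* (a :+ b) :+ q :* (c :+ d) := (p :* a :+ q :* c) :+ (p :* b :+ q :* d))
    refl p q (𝔼 d₁ f) (𝔼 d₁ g) (𝔼 d₂ f) (𝔼 d₂ g))

𝔼-*ʳ : ∀ (d : Dist A) (f : A → ℚ) r → 𝔼 d (λ a → f a * r) ≡ 𝔼 d f * r
𝔼-*ʳ (return a) f r = refl
𝔼-*ʳ (mix {p} {q} _ _ _ d₁ d₂) f r = trans
  (cong₂ (λ x y → p * x + q * y) (𝔼-*ʳ d₁ f r) (𝔼-*ʳ d₂ f r))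
  (solve 5 (λ p q a b r → p :* (a :* r) :+ q :* (b :* r) := (p :* a :+ q :* b) :* r)
    refl p q (𝔼 d₁ f) (𝔼 d₂ f) r)

𝔼->>= : ∀ (d : Dist A) (k : A → Dist B) f → 𝔼 (d >>= k) f ≡ 𝔼 d (λ a → 𝔼 (k a) f)
𝔼->>= (return a) k f = refl
𝔼->>= (mix {p} {q} _ _ _ d₁ d₂) k f = cong₂ (λ x y → p * x + q * y) (𝔼->>= d₁ k f) (𝔼->>= d₂ k f)

𝔼-<$> : ∀ (g : A → B) d f → 𝔼 (g <$> d) f ≡ 𝔼 d (f ∘ g)
𝔼-<$> g d f = 𝔼->>= d (return ∘ g) f

infixr 5 _◂_
_◂_ : A → (ℕ → A) → (ℕ → A)
(a ◂ f) zero    = a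
(a ◂ f) (suc n) = f n

-- From index t on, the drawn sequence has the junk value a.
independent : A → ℕ → (ℕ → Dist A) → Dist (ℕ → A)
independent a zero    d = return (λ _ → a)
independent a (suc t) d = d 0 >>= λ x → x ◂_ <$> independent a t (d ∘ suc)

module _ (a : A) where

  𝔼-independent-suc : ∀ t d F → 𝔼 (independent a (suc t) d) F ≡
    𝔼 (d 0) (λ x → 𝔼 (independent a t (d ∘ suc)) (λ ω → F (x ◂ ω)))
  𝔼-independent-suc t d F = trans (𝔼->>= (d 0) _ F)
    (𝔼-cong (d 0) (λ x → 𝔼-<$> (x ◂_) (independent a t (d ∘ suc)) F))

  𝔼-independent-marginal : ∀ t d {b} f → b ℕ.< t → 𝔼 (independent a t d) (λ ω → f (ω b)) ≡ 𝔼 (d b) f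
  𝔼-independent-marginal (suc t) d {zero} f _ = trans (𝔼-independent-suc t d _)
    (𝔼-cong (d 0) (λ x → 𝔼-const (independent a t (d ∘ suc)) (f x)))
  𝔼-independent-marginal (suc t) d {suc b} f (ℕ.s≤s b<t) = begin
    𝔼 (independent a (suc t) d) (λ ω → f (ω (suc b)))
      ≡⟨ 𝔼-independent-suc t d _ ⟩
    𝔼 (d 0) (λ _ → 𝔼 (independent a t (d ∘ suc)) (λ ω → f (ω b)))
      ≡⟨ 𝔼-const (d 0) _ ⟩
    𝔼 (independent a t (d ∘ suc)) (λ ω → f (ω b))
      ≡⟨ 𝔼-independent-marginal t (d ∘ suc) f b<t ⟩
    𝔼 (d (suc b)) f ∎
    where open ≡-Reasoning

  -- Coordinates are peeled off until the earlier one, `b`, comes first; its factor is then constant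
  -- for the remaining draws.
  𝔼-independent-* : ∀ t d {b b′} f g → b ℕ.< b′ → b′ ℕ.< t →
    𝔼 (independent a t d) (λ ω → f (ω b) * g (ω b′)) ≡ 𝔼 (d b) f * 𝔼 (d b′) g
  𝔼-independent-* (suc t) d {zero} {suc b′} f g _ (ℕ.s≤s b′<t) = begin
    𝔼 (independent a (suc t) d) (λ ω → f (ω 0) * g (ω (suc b′)))
      ≡⟨ 𝔼-independent-suc t d _ ⟩
    𝔼 (d 0) (λ x → 𝔼 rest (λ ω → f x * g (ω b′)))
      ≡⟨ 𝔼-cong (d 0) (λ x → trans (𝔼-cong rest (λ ω → *-comm (f x) (g (ω b′))))
           (trans (𝔼-*ʳ rest (λ ω → g (ω b′)) (f x))
             (trans (*-comm _ (f x)) (cong (f x *_) (𝔼-independent-marginal t (d ∘ suc) g b′<t))))) ⟩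
    𝔼 (d 0) (λ x → f x * 𝔼 (d (suc b′)) g)
      ≡⟨ 𝔼-*ʳ (d 0) f _ ⟩
    𝔼 (d 0) f * 𝔼 (d (suc b′)) g ∎
    where
    open ≡-Reasoning
    rest = independent a t (d ∘ suc)
  𝔼-independent-* (suc t) d {suc b} {suc b′} f g (ℕ.s≤s b<b′) (ℕ.s≤s b′<t) = begin
    𝔼 (independent a (suc t) d) (λ ω → f (ω (suc b)) * g (ω (suc b′)))
      ≡⟨ 𝔼-independent-suc t d _ ⟩
    𝔼 (d 0) (λ _ → 𝔼 rest (λ ω → f (ω b) * g (ω b′)))
      ≡⟨ 𝔼-const (d 0) _ ⟩
    𝔼 rest (λ ω → f (ω b) * g (ω b′))
      ≡⟨ 𝔼-independent-* t (d ∘ suc) f g b<b′ b′<t ⟩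
    𝔼 (d (suc b)) f * 𝔼 (d (suc b′)) g ∎
    where
    open ≡-Reasoning
    rest = independent a t (d ∘ suc)

-- Drawing without replacement.

⟦_⟧ : Bool → ℚ
⟦ b ⟧ = if b then 1ℚ else 0ℚ

-- The characteristic function of a uniformly random k-subset of {0, …, k + m - 1}.
urn : ℕ → ℕ → Dist (ℕ → Bool)
urn zero    m       = return (λ _ → false)
urn (suc k) zero    = return (λ _ → true)
urn (suc k) (suc m) = mix {p = fromℕ (suc k) * 1/N} {q = fromℕ (suc m) * 1/N}
  (*-nonNeg (fromℕ-nonNeg (suc k)) (1/suc≥0 (k ℕ.+ suc m)))
  (*-nonNeg (fromℕ-nonNeg (suc m)) (1/suc≥0 (k ℕ.+ suc m)))
  (trans (sym (*-distribʳ-+ 1/N (fromℕ (suc k)) (fromℕ (suc m))))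
    (trans (cong (_* 1/N) (sym (fromℕ-+ (suc k) (suc m)))) (suc*1/suc (k ℕ.+ suc m))))
  (true ◂_ <$> urn k (suc m)) (false ◂_ <$> urn (suc k) m)
  where 1/N = 1/suc (k ℕ.+ suc m)

module _ (k m : ℕ) where

  private
    K = fromℕ (suc k)
    M = fromℕ (suc m)
    N = fromℕ (suc k ℕ.+ suc m)

  -- Conditioning on whether 0 is drawn. As in the lemmas below, the population size is multiplied
  -- out, which keeps the inductions within polynomial identities.
  urn-step : ∀ F → N * 𝔼 (urn (suc k) (suc m)) F ≡
    K * 𝔼 (urn k (suc m)) (λ x → F (true ◂ x)) + M * 𝔼 (urn (suc k) m) (λ x → F (false ◂ x))
  urn-step F = begin
    N * (K * 1/N * 𝔼 (true ◂_ <$> urn k (suc m)) F + M * 1/N * 𝔼 (false ◂_ <$> urn (suc k) m) F)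
      ≡⟨ cong₂ (λ x y → N * (K * 1/N * x + M * 1/N * y))
           (𝔼-<$> (true ◂_) (urn k (suc m)) F) (𝔼-<$> (false ◂_) (urn (suc k) m) F) ⟩
    N * (K * 1/N * p + M * 1/N * q)
      ≡⟨ solve 6 (λ n i k m p q → n :* (k :* i :* p :+ m :* i :* q) := n :* i :* (k :* p :+ m :* q))
           refl N 1/N K M p q ⟩
    N * 1/N * (K * p + M * q)
      ≡⟨ cong (_* (K * p + M * q)) (suc*1/suc (k ℕ.+ suc m)) ⟩
    1ℚ * (K * p + M * q)
      ≡⟨ *-identityˡ _ ⟩
    K * p + M * q ∎
    where
    open ≡-Reasoning
    1/N = 1/suc (k ℕ.+ suc m)
    p = 𝔼 (urn k (suc m)) (λ x → F (true ◂ x))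
    q = 𝔼 (urn (suc k) m) (λ x → F (false ◂ x))

urn-inside : ∀ k m {i} → i ℕ.< k ℕ.+ m →
  fromℕ (k ℕ.+ m) * 𝔼 (urn k m) (λ x → ⟦ x i ⟧) ≡ fromℕ k
urn-inside zero    m       i<n = *-zeroʳ (fromℕ m)
urn-inside (suc k) zero    i<n = trans (*-identityʳ _) (cong fromℕ (ℕₚ.+-identityʳ (suc k)))
urn-inside (suc k) (suc m) {zero} i<n = begin
  fromℕ (suc k ℕ.+ suc m) * 𝔼 (urn (suc k) (suc m)) (λ x → ⟦ x 0 ⟧)
    ≡⟨ urn-step k m _ ⟩
  fromℕ (suc k) * 𝔼 (urn k (suc m)) (λ _ → 1ℚ) + fromℕ (suc m) * 𝔼 (urn (suc k) m) (λ _ → 0ℚ)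
    ≡⟨ cong₂ (λ x y → fromℕ (suc k) * x + fromℕ (suc m) * y) (𝔼-const (urn k (suc m)) 1ℚ) (𝔼-const (urn (suc k) m) 0ℚ) ⟩
  fromℕ (suc k) * 1ℚ + fromℕ (suc m) * 0ℚ
    ≡⟨ solve 2 (λ x y → x :* con 1ℚ :+ y :* con 0ℚ := x) refl (fromℕ (suc k)) (fromℕ (suc m)) ⟩
  fromℕ (suc k) ∎
  where open ≡-Reasoning
-- Whatever happens to element 0, `N′` elements remain, and the chance is k / N′ or (k + 1) / N′;
-- the factor `N′` clears both denominators.
urn-inside (suc k) (suc m) {suc i} (ℕ.s≤s i<n) = *-cancel-pos-≡ N′ (0<fromℕ (ℕₚ.≤-<-trans ℕ.z≤n i<n)) (begin
  N′ * (fromℕ (suc k ℕ.+ suc m) * 𝔼 (urn (suc k) (suc m)) (λ x → ⟦ x (suc i) ⟧))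
    ≡⟨ cong (N′ *_) (urn-step k m _) ⟩
  N′ * (K * p + M * q)
    ≡⟨ solve 5 (λ n k m p q → n :* (k :* p :+ m :* q) := k :* (n :* p) :+ m :* (n :* q)) refl N′ K M p q ⟩
  K * (N′ * p) + M * (N′ * q)
    ≡⟨ cong₂ (λ x y → K * x + M * y) (urn-inside k (suc m) i<n)
         (subst (λ n → fromℕ n * q ≡ K) (sym (ℕₚ.+-suc k m))
           (urn-inside (suc k) m (subst (i ℕ.<_) (ℕₚ.+-suc k m) i<n))) ⟩
  K * fromℕ k + M * K
    ≡⟨ solve 3 (λ k x m → k :* x :+ m :* k := (x :+ m) :* k) refl K (fromℕ k) M ⟩
  (fromℕ k + M) * K
    ≡⟨ cong (_* K) (fromℕ-+ k (suc m)) ⟨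
  N′ * K ∎)
  where
  open ≡-Reasoning
  K = fromℕ (suc k)
  M = fromℕ (suc m)
  N′ = fromℕ (k ℕ.+ suc m)
  p = 𝔼 (urn k (suc m)) (λ x → ⟦ x i ⟧)
  q = 𝔼 (urn (suc k) m) (λ x → ⟦ x i ⟧)

⟦⟧+⟦not⟧ : ∀ b → ⟦ b ⟧ + ⟦ not b ⟧ ≡ 1ℚ
⟦⟧+⟦not⟧ true  = refl
⟦⟧+⟦not⟧ false = refl

urn-outside : ∀ k m {i} → i ℕ.< k ℕ.+ m →
  fromℕ (k ℕ.+ m) * 𝔼 (urn k m) (λ x → ⟦ not (x i) ⟧) ≡ fromℕ m
urn-outside k m {i} i<n = begin
  N * Q               ≡⟨ solve 3 (λ n p q → n :* q := n :* (p :+ q) :- n :* p) refl N P Q ⟩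
  N * (P + Q) - N * P ≡⟨ cong₂ (λ x y → N * x - y) P+Q≡1 (urn-inside k m i<n) ⟩
  N * 1ℚ - fromℕ k    ≡⟨ cong (λ n → n * 1ℚ - fromℕ k) (fromℕ-+ k m) ⟩
  (fromℕ k + fromℕ m) * 1ℚ - fromℕ k
    ≡⟨ solve 2 (λ k m → (k :+ m) :* con 1ℚ :- k := m) refl (fromℕ k) (fromℕ m) ⟩
  fromℕ m ∎
  where
  open ≡-Reasoning
  N = fromℕ (k ℕ.+ m)
  P = 𝔼 (urn k m) (λ x → ⟦ x i ⟧)
  Q = 𝔼 (urn k m) (λ x → ⟦ not (x i) ⟧)
  P+Q≡1 : P + Q ≡ 1ℚ
  P+Q≡1 = trans (sym (𝔼-+ (urn k m) _ _))
    (trans (𝔼-cong (urn k m) (λ x → ⟦⟧+⟦not⟧ (x i))) (𝔼-const (urn k m) 1ℚ))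

-- Independent draws would give k m / N²; the smaller denominator N (N - 1) is the gain from not
-- replacing. Conditioning on element 0 leaves a question about one element if `i` or `j` is 0, and
-- the same question otherwise.
urn-pair : ∀ k m {i j} → i ≢ j → i ℕ.< k ℕ.+ m → j ℕ.< k ℕ.+ m →
  fromℕ (k ℕ.+ m) * (fromℕ (k ℕ.+ m) - 1ℚ) * 𝔼 (urn k m) (λ x → ⟦ x i ⟧ * ⟦ not (x j) ⟧)
    ≡ fromℕ k * fromℕ m
urn-pair zero m i≢j i<n j<n =
  solve 1 (λ m → m :* (m :- con 1ℚ) :* con 0ℚ := con 0ℚ :* m) refl (fromℕ m)
urn-pair (suc k) zero i≢j i<n j<n =
  solve 2 (λ m k → m :* (m :- con 1ℚ) :* con 0ℚ := k :* con 0ℚ) refl (fromℕ (suc k ℕ.+ 0)) (fromℕ (suc k))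
urn-pair (suc k) (suc m) {i} {j} i≢j i<n j<n = trans
  (solve 2 (λ n e → (con 1ℚ :+ n) :* (con 1ℚ :+ n :- con 1ℚ) :* e := n :* ((con 1ℚ :+ n) :* e))
    refl N′ (E i j))
  (trans (cong (N′ *_) (urn-step k m _)) (cases i j i≢j i<n j<n))
  where
  open ≡-Reasoning
  K = fromℕ (suc k)
  M = fromℕ (suc m)
  N′ = fromℕ (k ℕ.+ suc m)
  d₁ = urn k (suc m)
  d₂ = urn (suc k) m
  F : ℕ → ℕ → (ℕ → Bool) → ℚ
  F i j x = ⟦ x i ⟧ * ⟦ not (x j) ⟧
  E : ℕ → ℕ → ℚ
  E i j = 𝔼 (urn (suc k) (suc m)) (F i j)

  cases : ∀ i j → i ≢ j → i ℕ.< suc k ℕ.+ suc m → j ℕ.< suc k ℕ.+ suc m →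
    N′ * (K * 𝔼 d₁ (λ x → F i j (true ◂ x)) + M * 𝔼 d₂ (λ x → F i j (false ◂ x))) ≡ K * M
  cases zero zero i≢j _ _ = contradiction refl i≢j
  cases zero (suc j) _ _ (ℕ.s≤s j<n) = begin
    N′ * (K * 𝔼 d₁ (λ x → 1ℚ * ⟦ not (x j) ⟧) + M * 𝔼 d₂ (λ x → 0ℚ * ⟦ not (x j) ⟧))
      ≡⟨ cong₂ (λ x y → N′ * (K * x + M * y))
           (𝔼-cong d₁ (λ x → *-identityˡ _))
           (trans (𝔼-cong d₂ (λ x → *-zeroˡ ⟦ not (x j) ⟧)) (𝔼-const d₂ 0ℚ)) ⟩
    N′ * (K * q + M * 0ℚ)
      ≡⟨ solve 4 (λ n k m q → n :* (k :* q :+ m :* con 0ℚ) := k :* (n :* q)) refl N′ K M q ⟩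
    K * (N′ * q)
      ≡⟨ cong (K *_) (urn-outside k (suc m) j<n) ⟩
    K * M ∎
    where q = 𝔼 d₁ (λ x → ⟦ not (x j) ⟧)
  cases (suc i) zero _ (ℕ.s≤s i<n) _ = begin
    N′ * (K * 𝔼 d₁ (λ x → ⟦ x i ⟧ * 0ℚ) + M * 𝔼 d₂ (λ x → ⟦ x i ⟧ * 1ℚ))
      ≡⟨ cong₂ (λ x y → N′ * (K * x + M * y))
           (trans (𝔼-cong d₁ (λ x → *-zeroʳ ⟦ x i ⟧)) (𝔼-const d₁ 0ℚ))
           (𝔼-cong d₂ (λ x → *-identityʳ _)) ⟩
    N′ * (K * 0ℚ + M * p)
      ≡⟨ solve 4 (λ n k m p → n :* (k :* con 0ℚ :+ m :* p) := n :* p :* m) refl N′ K M p ⟩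
    N′ * p * M
      ≡⟨ cong (_* M) (subst (λ n → fromℕ n * p ≡ K) (sym (ℕₚ.+-suc k m))
           (urn-inside (suc k) m (subst (i ℕ.<_) (ℕₚ.+-suc k m) i<n))) ⟩
    K * M ∎
    where p = 𝔼 d₂ (λ x → ⟦ x i ⟧)
  cases (suc i) (suc j) si≢sj (ℕ.s≤s i<n) (ℕ.s≤s j<n) = *-cancel-pos-≡ (N′ - 1ℚ) 0<N′-1 (begin
    (N′ - 1ℚ) * (N′ * (K * p + M * q))
      ≡⟨ solve 5 (λ n k m p q → (n :- con 1ℚ) :* (n :* (k :* p :+ m :* q)) :=
           k :* (n :* (n :- con 1ℚ) :* p) :+ m :* (n :* (n :- con 1ℚ) :* q)) refl N′ K M p q ⟩
    K * (N′ * (N′ - 1ℚ) * p) + M * (N′ * (N′ - 1ℚ) * q)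
      ≡⟨ cong₂ (λ x y → K * x + M * y) (urn-pair k (suc m) i≢j′ i<n j<n)
           (subst (λ n → fromℕ n * (fromℕ n - 1ℚ) * q ≡ K * fromℕ m) (sym (ℕₚ.+-suc k m))
             (urn-pair (suc k) m i≢j′ (subst (i ℕ.<_) (ℕₚ.+-suc k m) i<n) (subst (j ℕ.<_) (ℕₚ.+-suc k m) j<n))) ⟩
    K * (fromℕ k * M) + M * (K * fromℕ m)
      ≡⟨ solve 4 (λ k m x y → k :* (x :* m) :+ m :* (k :* y) := (x :+ y) :* (k :* m)) refl K M (fromℕ k) (fromℕ m) ⟩
    (fromℕ k + fromℕ m) * (K * M)
      ≡⟨ cong (_* (K * M)) (trans N′-1≡ (fromℕ-+ k m)) ⟨
    (N′ - 1ℚ) * (K * M) ∎)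
    where
    p = 𝔼 d₁ (λ x → ⟦ x i ⟧ * ⟦ not (x j) ⟧)
    q = 𝔼 d₂ (λ x → ⟦ x i ⟧ * ⟦ not (x j) ⟧)
    i≢j′ = si≢sj ∘ cong suc
    N′-1≡ : N′ - 1ℚ ≡ fromℕ (k ℕ.+ m)
    N′-1≡ = trans (cong (λ n → fromℕ n - 1ℚ) (ℕₚ.+-suc k m))
      (solve 1 (λ x → con 1ℚ :+ x :- con 1ℚ := x) refl (fromℕ (k ℕ.+ m)))
    -- Two distinct places among `N′` force N′ > 1, so the factor `N′ - 1` may be cancelled.
    distinct⇒0< : ∀ {i j n} → i ≢ j → i ℕ.< suc n → j ℕ.< suc n → 0 ℕ.< n
    distinct⇒0< {zero}  {zero}  i≢j _ _ = contradiction refl i≢j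
    distinct⇒0< {zero}  {suc j} _ _ (ℕ.s≤s j<n) = ℕₚ.≤-<-trans ℕ.z≤n j<n
    distinct⇒0< {suc i} _ (ℕ.s≤s i<n) _ = ℕₚ.≤-<-trans ℕ.z≤n i<n
    0<N′-1 : 0ℚ < N′ - 1ℚ
    0<N′-1 = subst (0ℚ <_) (sym N′-1≡) (0<fromℕ (distinct⇒0< i≢j′
      (subst (i ℕ.<_) (ℕₚ.+-suc k m) i<n) (subst (j ℕ.<_) (ℕₚ.+-suc k m) j<n)))

-- The random set of layers.

-- In terms of the proof idea above, e = h - D, w = 2D and b = D + d.
module Layers (e w : ℕ) (0<e : 0 ℕ.< e) where

  -- The block size 2h = 2e + w, written as a successor: `N` is then visibly nonzero as a divisor,
  -- and `N-1` needs no subtraction.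
  N N-1 : ℕ
  N   = suc (ℕ.pred e ℕ.+ (e ℕ.+ w))
  N-1 = ℕ.pred e ℕ.+ (e ℕ.+ w)

  N≡ : N ≡ e ℕ.+ (e ℕ.+ w)
  N≡ = cong (ℕ._+ (e ℕ.+ w)) (ℕₚ.suc-pred e {{ℕ.>-nonZero 0<e}})

  private
    block-size : ∀ {b} → b ℕ.≤ w → e ℕ.+ b ℕ.+ (e ℕ.+ (w ℕ.∸ b)) ≡ N
    block-size {b} b≤w = trans
      (solveℕ 3 (λ e b c → e ⊕ b ⊕ (e ⊕ c) ⊜ e ⊕ (e ⊕ (b ⊕ c))) refl e b (w ℕ.∸ b))
      (trans (cong (λ w → e ℕ.+ (e ℕ.+ w)) (ℕₚ.m+[n∸m]≡n b≤w)) (sym N≡))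

  block : ℕ → Dist (ℕ → Bool)
  block b = urn (e ℕ.+ b) (e ℕ.+ (w ℕ.∸ b))

  cut : Dist (ℕ → Bool)
  cut = (λ ω i → ω (i ℕ./ N) (i ℕ.% N)) <$> independent (λ _ → false) (suc w) block

  -- The right side exceeds the left by b (w - b), so the outermost blocks are the worst.
  same-block-ℕ : ∀ {b} → b ℕ.≤ w → e ℕ.* (e ℕ.+ w) ℕ.≤ (e ℕ.+ b) ℕ.* (e ℕ.+ (w ℕ.∸ b))
  same-block-ℕ {b} b≤w = begin
    e ℕ.* (e ℕ.+ w)               ≡⟨ cong (λ w → e ℕ.* (e ℕ.+ w)) (ℕₚ.m+[n∸m]≡n b≤w) ⟨
    e ℕ.* (e ℕ.+ (b ℕ.+ a))       ≤⟨ ℕₚ.m≤m+n _ (b ℕ.* a) ⟩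
    e ℕ.* (e ℕ.+ (b ℕ.+ a)) ℕ.+ b ℕ.* a
      ≡⟨ solveℕ 3 (λ e b c → e ⊗ (e ⊕ (b ⊕ c)) ⊕ b ⊗ c ⊜ (e ⊕ b) ⊗ (e ⊕ c)) refl e b a ⟩
    (e ℕ.+ b) ℕ.* (e ℕ.+ a) ∎
    where
    open ℕₚ.≤-Reasoning
    a = w ℕ.∸ b

  -- For blocks b′ < b; what is lost against N² in the denominator is regained from b > b′.
  diff-block-ℕ : ∀ {b b′} → b ℕ.≤ w → b′ ℕ.< b →
    N ℕ.* (e ℕ.* (e ℕ.+ w)) ℕ.≤ N-1 ℕ.* ((e ℕ.+ b) ℕ.* (e ℕ.+ (w ℕ.∸ b′)))
  diff-block-ℕ {b} {b′} b≤w b′<b = begin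
    -- The step from b′ to b enlarges the last factor by at least 1, which is worth e + b ≥ e; this
    -- pays for the extra `G`, as G ≤ (N - 1) e.
    G ℕ.+ N-1 ℕ.* G                          ≤⟨ ℕₚ.+-monoˡ-≤ (N-1 ℕ.* G) G≤ ⟩
    N-1 ℕ.* e ℕ.+ N-1 ℕ.* G                  ≡⟨ ℕₚ.*-distribˡ-+ N-1 e G ⟨
    N-1 ℕ.* (e ℕ.+ G)                        ≤⟨ ℕₚ.*-monoʳ-≤ N-1 (begin
      e ℕ.+ G                                  ≤⟨ ℕₚ.+-monoʳ-≤ e (same-block-ℕ b≤w) ⟩
      e ℕ.+ (e ℕ.+ b) ℕ.* (e ℕ.+ a)            ≤⟨ ℕₚ.+-monoˡ-≤ _ (ℕₚ.m≤m+n e b) ⟩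
      e ℕ.+ b ℕ.+ (e ℕ.+ b) ℕ.* (e ℕ.+ a)      ≡⟨ ℕₚ.*-suc (e ℕ.+ b) (e ℕ.+ a) ⟨
      (e ℕ.+ b) ℕ.* suc (e ℕ.+ a)              ≡⟨ cong ((e ℕ.+ b) ℕ.*_) (ℕₚ.+-suc e a) ⟨
      (e ℕ.+ b) ℕ.* (e ℕ.+ suc a)              ≤⟨ ℕₚ.*-monoʳ-≤ (e ℕ.+ b) (ℕₚ.+-monoʳ-≤ e a<a′) ⟩
      (e ℕ.+ b) ℕ.* (e ℕ.+ (w ℕ.∸ b′))         ∎) ⟩
    N-1 ℕ.* ((e ℕ.+ b) ℕ.* (e ℕ.+ (w ℕ.∸ b′))) ∎
    where
    open ℕₚ.≤-Reasoning
    G = e ℕ.* (e ℕ.+ w)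
    a = w ℕ.∸ b
    a<a′ : a ℕ.< w ℕ.∸ b′
    a<a′ = ℕₚ.∸-monoʳ-< b′<b b≤w
    G≤ : G ℕ.≤ N-1 ℕ.* e
    G≤ = ℕₚ.≤-trans (ℕₚ.≤-reflexive (ℕₚ.*-comm e (e ℕ.+ w))) (ℕₚ.*-monoˡ-≤ e (ℕₚ.m≤n+m (e ℕ.+ w) (ℕ.pred e)))

  separates : (ℕ → Bool) → ℕ → ℕ → ℚ
  separates x i j = ⟦ x i ⟧ * ⟦ not (x j) ⟧

  -- The bound (h - D) (h + D) / (2h (2h - 1)) without denominators. As j < i, layer `j` lies in the
  -- block of `i` or an earlier one: `urn-pair` settles the former case, independence the latter.
  cut-separates : ∀ {i j} → j ℕ.< i → i ℕ.< suc w ℕ.* N →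
    fromℕ (e ℕ.* (e ℕ.+ w)) ≤ fromℕ N * fromℕ N-1 * 𝔼 cut (λ x → separates x i j)
  cut-separates {i} {j} j<i i<wN = subst (λ p → G ≤ fromℕ N * fromℕ N-1 * p) (sym (𝔼-<$> _ Ω _)) main
    where
    open ≤-Reasoning
    Ω = independent (λ _ → false) (suc w) block
    G = fromℕ (e ℕ.* (e ℕ.+ w))
    b = i ℕ./ N
    b′ = j ℕ./ N
    b<1+w : b ℕ.< suc w
    b<1+w = ℕ.m<n*o⇒m/o<n i<wN
    b′<1+w : b′ ℕ.< suc w
    b′<1+w = ℕ.m<n*o⇒m/o<n (ℕₚ.<-trans j<i i<wN)
    r<  : ∀ i {b} → b ℕ.≤ w → i ℕ.% N ℕ.< e ℕ.+ b ℕ.+ (e ℕ.+ (w ℕ.∸ b))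
    r< i b≤w = subst (i ℕ.% N ℕ.<_) (sym (block-size b≤w)) (ℕ.m%n<n i N)

    main : G ≤ fromℕ N * fromℕ N-1 * 𝔼 Ω (λ ω → ⟦ ω b (i ℕ.% N) ⟧ * ⟦ not (ω b′ (j ℕ.% N)) ⟧)
    main with ℕₚ.<-cmp b′ b
    ... | tri> _ _ b<b′ = contradiction b<b′ (ℕₚ.≤⇒≯ (ℕ./-monoˡ-≤ N (ℕₚ.<⇒≤ j<i)))
    ... | tri≈ _ b′≡b _ = begin
      G ≤⟨ fromℕ-mono (same-block-ℕ b≤w) ⟩
      fromℕ ((e ℕ.+ b) ℕ.* (e ℕ.+ (w ℕ.∸ b)))
        ≡⟨ fromℕ-* (e ℕ.+ b) (e ℕ.+ (w ℕ.∸ b)) ⟩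
      fromℕ (e ℕ.+ b) * fromℕ (e ℕ.+ (w ℕ.∸ b))
        ≡⟨ urn-pair (e ℕ.+ b) (e ℕ.+ (w ℕ.∸ b)) i%N≢j%N (r< i b≤w) (r< j b≤w) ⟨
      fromℕ (e ℕ.+ b ℕ.+ (e ℕ.+ (w ℕ.∸ b))) * (fromℕ (e ℕ.+ b ℕ.+ (e ℕ.+ (w ℕ.∸ b))) - 1ℚ) * P
        ≡⟨ cong (λ n → fromℕ n * (fromℕ n - 1ℚ) * P) (block-size b≤w) ⟩
      fromℕ N * (fromℕ N - 1ℚ) * P
        ≡⟨ cong (λ p → fromℕ N * p * P) (solve 1 (λ x → con 1ℚ :+ x :- con 1ℚ := x) refl (fromℕ N-1)) ⟩
      fromℕ N * fromℕ N-1 * P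
        ≡⟨ cong (λ p → fromℕ N * fromℕ N-1 * p) (𝔼-independent-marginal _ (suc w) block _ b<1+w) ⟨
      fromℕ N * fromℕ N-1 * 𝔼 Ω (λ ω → ⟦ ω b (i ℕ.% N) ⟧ * ⟦ not (ω b (j ℕ.% N)) ⟧)
        ≡⟨ cong (λ a → fromℕ N * fromℕ N-1 * 𝔼 Ω (λ ω → ⟦ ω b (i ℕ.% N) ⟧ * ⟦ not (ω a (j ℕ.% N)) ⟧)) b′≡b ⟨
      fromℕ N * fromℕ N-1 * 𝔼 Ω (λ ω → ⟦ ω b (i ℕ.% N) ⟧ * ⟦ not (ω b′ (j ℕ.% N)) ⟧) ∎
      where
      b≤w = ℕ.s≤s⁻¹ b<1+w
      P = 𝔼 (block b) (λ x → ⟦ x (i ℕ.% N) ⟧ * ⟦ not (x (j ℕ.% N)) ⟧)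
      i%N≢j%N : i ℕ.% N ≢ j ℕ.% N
      i%N≢j%N eq = ℕₚ.<⇒≢ j<i (trans (ℕ.m≡m%n+[m/n]*n j N)
        (trans (cong₂ (λ r q → r ℕ.+ q ℕ.* N) (sym eq) b′≡b) (sym (ℕ.m≡m%n+[m/n]*n i N))))
    -- A product of two independent probabilities has denominator N², whence the extra factor `N`.
    ... | tri< b′<b _ _ = *-cancelˡ-≤-pos (fromℕ N) {{positive (fromℕ-pos N-1)}} (begin
      fromℕ N * G
        ≡⟨ fromℕ-* N (e ℕ.* (e ℕ.+ w)) ⟨
      fromℕ (N ℕ.* (e ℕ.* (e ℕ.+ w)))
        ≤⟨ fromℕ-mono (diff-block-ℕ b≤w b′<b) ⟩
      fromℕ (N-1 ℕ.* ((e ℕ.+ b) ℕ.* (e ℕ.+ (w ℕ.∸ b′))))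
        ≡⟨ trans (fromℕ-* N-1 _) (cong (fromℕ N-1 *_) (fromℕ-* (e ℕ.+ b) _)) ⟩
      fromℕ N-1 * (fromℕ (e ℕ.+ b) * fromℕ (e ℕ.+ (w ℕ.∸ b′)))
        ≡⟨ cong₂ (λ p q → fromℕ N-1 * (p * q))
             (subst (λ n → fromℕ n * P ≡ fromℕ (e ℕ.+ b)) (block-size b≤w)
               (urn-inside (e ℕ.+ b) _ (r< i b≤w)))
             (subst (λ n → fromℕ n * Q ≡ fromℕ (e ℕ.+ (w ℕ.∸ b′))) (block-size b′≤w)
               (urn-outside (e ℕ.+ b′) _ (r< j b′≤w))) ⟨
      fromℕ N-1 * (fromℕ N * P * (fromℕ N * Q))
        ≡⟨ solve 4 (λ m n p q → m :* (n :* p :* (n :* q)) := n :* (n :* m :* (p :* q))) refl (fromℕ N-1) (fromℕ N) P Q ⟩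
      fromℕ N * (fromℕ N * fromℕ N-1 * (P * Q))
        -- The factors are swapped because `𝔼-independent-*` takes the earlier block first, here
        -- that of `j`.
        ≡⟨ cong (λ p → fromℕ N * (fromℕ N * fromℕ N-1 * p)) (trans
             (𝔼-cong Ω (λ ω → *-comm ⟦ ω b (i ℕ.% N) ⟧ ⟦ not (ω b′ (j ℕ.% N)) ⟧))
             (trans (𝔼-independent-* _ (suc w) block (λ x → ⟦ not (x (j ℕ.% N)) ⟧) (λ x → ⟦ x (i ℕ.% N) ⟧) b′<b b<1+w) (*-comm Q P))) ⟨
      fromℕ N * (fromℕ N * fromℕ N-1 * 𝔼 Ω (λ ω → ⟦ ω b (i ℕ.% N) ⟧ * ⟦ not (ω b′ (j ℕ.% N)) ⟧)) ∎)
      where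
      b≤w = ℕ.s≤s⁻¹ b<1+w
      b′≤w = ℕ.s≤s⁻¹ b′<1+w
      P = 𝔼 (block b) (λ x → ⟦ x (i ℕ.% N) ⟧)
      Q = 𝔼 (block b′) (λ x → ⟦ not (x (j ℕ.% N)) ⟧)

-- Comparison of the separation probability with 1/4 + k₂ ν^(-2/3).

fromℕ*1/ : ∀ n .{{_ : NonZero n}} → fromℕ n * (ℤ.+ 1 / n) ≡ 1ℚ
-- `_/_` reduces to lowest terms, so the product is evaluated among unnormalised rationals.
fromℕ*1/ (suc n) = toℚᵘ-injective (begin
  toℚᵘ (fromℕ (suc n) * (ℤ.+ 1 / suc n))
    ≈⟨ toℚᵘ-homo-* (fromℕ (suc n)) (ℤ.+ 1 / suc n) ⟩
  toℚᵘ (fromℕ (suc n)) ℚᵘ.* toℚᵘ (ℤ.+ 1 / suc n)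
    ≈⟨ ℚᵘₚ.*-cong (toℚᵘ-fromℕ (suc n)) (toℚᵘ-fromℚᵘ (ℚᵘ.mkℚᵘ (ℤ.+ 1) n)) ⟩
  ℚᵘ.mkℚᵘ (ℤ.+ suc n) 0 ℚᵘ.* ℚᵘ.mkℚᵘ (ℤ.+ 1) n
    ≈⟨ ℚᵘ.*≡* (cong ℤ.+_ (solveℕ 1 (λ n → (conℕ 1 ⊕ n) ⊗ conℕ 1 ⊗ conℕ 1 ⊜ conℕ 1 ⊗ (conℕ 1 ⊕ n ⊕ conℕ 0)) refl n)) ⟩
  ℚᵘ.1ℚᵘ ∎)
  where open ℚᵘₚ.≃-Reasoning

³-strict-mono : ∀ {p q} → 0ℚ ≤ p → p < q → p ³ < q ³
³-strict-mono {p} {q} 0≤p p<q = ≤-<-trans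
  (*-mono-≤-nonNeg (*-nonNeg 0≤p 0≤p) 0≤p (*-mono-≤-nonNeg 0≤p 0≤q p≤q p≤q) ≤-refl)
  (*-monoʳ-<-pos (q * q) {{pos*pos⇒pos q {{q>0}} q {{q>0}}}} p<q)
  where
  p≤q = <⇒≤ p<q
  0≤q = ≤-trans 0≤p p≤q
  q>0 : Positive q
  q>0 = positive (≤-<-trans 0≤p p<q)

1/n²≥0 : ∀ n .{{_ : NonZero n}} → 0ℚ ≤ (ℤ.+ 1 / n) * (ℤ.+ 1 / n)
1/n²≥0 n = *-nonNeg 0≤1/n 0≤1/n
  where 0≤1/n = nonNegative⁻¹ (ℤ.+ 1 / n) {{normalize-nonNeg 1 n}}

module _ (n : ℕ) .{{_ : NonZero n}} (i : ℕ) where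

  ^-⅔-nonNeg : 0ℚ ≤ seq (n ^-⅔) i
  ^-⅔-nonNeg = l-nonNeg (bisect-brackets _ (1/n²≥0 n) i)

  -- The approximations are lower ends of bisection intervals and never exceed the root. Hence the
  -- comparison holds at every index, with no error term.
  n²*^-⅔³≤1 : fromℕ n * fromℕ n * (seq (n ^-⅔) i) ³ ≤ 1ℚ
  n²*^-⅔³≤1 = begin
    fromℕ n * fromℕ n * (seq (n ^-⅔) i) ³
      ≤⟨ *-monoˡ-≤-nonNeg (fromℕ n * fromℕ n) {{nonNegative (*-nonNeg (fromℕ-nonNeg n) (fromℕ-nonNeg n))}}
           (l³≤q (bisect-brackets _ (1/n²≥0 n) i)) ⟩
    fromℕ n * fromℕ n * ((ℤ.+ 1 / n) * (ℤ.+ 1 / n))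
      ≡⟨ solve 2 (λ x y → x :* x :* (y :* y) := x :* y :* (x :* y)) refl (fromℕ n) (ℤ.+ 1 / n) ⟩
    fromℕ n * (ℤ.+ 1 / n) * (fromℕ n * (ℤ.+ 1 / n))
      ≡⟨ cong₂ _*_ (fromℕ*1/ n) (fromℕ*1/ n) ⟩
    1ℚ ∎
    where open ≤-Reasoning

*-mono-1 : ∀ {p q} → 0ℚ ≤ p → p ≤ 1ℚ → q ≤ 1ℚ → p * q ≤ 1ℚ
*-mono-1 0≤p p≤1 q≤1 = *-mono-≤-nonNeg 0≤p (nonNegative⁻¹ 1ℚ) p≤1 q≤1

module _ {ν : ℕ} .{{_ : NonZero ν}} (s : Scale ν) where
  open Scale s
  open Layers e (2 ℕ.* D) 0<e using (N; N-1)

  private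
    G : ℕ
    G = e ℕ.* (e ℕ.+ 2 ℕ.* D)
    P : ℚ
    P = fromℕ N * fromℕ N-1
    0<P : 0ℚ < P
    0<P = positive⁻¹ P {{pos*pos⇒pos (fromℕ N) {{positive (fromℕ-pos N-1)}}
      (fromℕ N-1) {{positive (0<fromℕ (ℕₚ.<-≤-trans 0<e
        (ℕₚ.≤-trans (ℕₚ.m≤m+n e (2 ℕ.* D)) (ℕₚ.m≤n+m (e ℕ.+ 2 ℕ.* D) (ℕ.pred e)))))}}}}
    1/P : ℚ
    1/P = (1/ P) {{>-nonZero 0<P}}
    instance
      P>0 = positive 0<P

  -- The bound of `cut-separates`, (h - D) (h + D) / (2h (2h - 1)).
  density : ℚ
  density = fromℕ G * 1/P

  density*P : density * P ≡ fromℕ G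
  density*P = trans (*-assoc (fromℕ G) 1/P P)
    (trans (cong (fromℕ G *_) (*-inverseˡ P {{>-nonZero 0<P}})) (*-identityʳ (fromℕ G)))

  ≤⇒density≤ : ∀ {p} → fromℕ G ≤ P * p → density ≤ p
  ≤⇒density≤ {p} G≤ = *-cancelʳ-≤-pos P (≤-trans (≤-reflexive density*P) (≤-trans G≤ (≤-reflexive (*-comm P p))))

  density-nonNeg : 0ℚ ≤ density
  density-nonNeg = *-nonNeg (fromℕ-nonNeg G) (<⇒≤ (positive⁻¹ 1/P {{1/pos⇒pos P}}))

  private
    -- Divided by 8 N (N - 1), this says that `density` is 1/4 + k / (2 N (N - 1)).
    8G≡ : 4 ℕ.* k ℕ.+ 2 ℕ.* (N ℕ.* N-1) ≡ 8 ℕ.* G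
    8G≡ = ℕₚ.+-cancelʳ-≡ (8 ℕ.* (D ℕ.* D)) _ _ (begin
      4 ℕ.* k ℕ.+ 2 ℕ.* (N ℕ.* N-1) ℕ.+ 8 ℕ.* (D ℕ.* D)
        ≡⟨ solveℕ 3 (λ k n d → conℕ 4 ⊗ k ⊕ conℕ 2 ⊗ n ⊕ conℕ 8 ⊗ d ⊜ conℕ 4 ⊗ (k ⊕ conℕ 2 ⊗ d) ⊕ conℕ 2 ⊗ n)
             refl k (N ℕ.* N-1) (D ℕ.* D) ⟩
      4 ℕ.* (k ℕ.+ 2 ℕ.* (D ℕ.* D)) ℕ.+ 2 ℕ.* (N ℕ.* N-1)
        ≡⟨ cong (λ h → 4 ℕ.* h ℕ.+ 2 ℕ.* (N ℕ.* N-1)) k+2D² ⟩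
      4 ℕ.* (e ℕ.+ D) ℕ.+ 2 ℕ.* (N ℕ.* N-1)
        ≡⟨ cong (λ x → 4 ℕ.* (x ℕ.+ D) ℕ.+ 2 ℕ.* (N ℕ.* N-1)) (ℕₚ.suc-pred e {{ℕ.>-nonZero 0<e}}) ⟨
      4 ℕ.* (suc f ℕ.+ D) ℕ.+ 2 ℕ.* (N ℕ.* N-1)
        ≡⟨ cong (λ x → 4 ℕ.* (suc f ℕ.+ D) ℕ.+ 2 ℕ.* (suc (f ℕ.+ (x ℕ.+ 2 ℕ.* D)) ℕ.* (f ℕ.+ (x ℕ.+ 2 ℕ.* D)))) (ℕₚ.suc-pred e {{ℕ.>-nonZero 0<e}}) ⟨
      4 ℕ.* (suc f ℕ.+ D) ℕ.+ 2 ℕ.* (suc (f ℕ.+ (suc f ℕ.+ 2 ℕ.* D)) ℕ.* (f ℕ.+ (suc f ℕ.+ 2 ℕ.* D)))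
        ≡⟨ solveℕ 2 (λ f d → let e = conℕ 1 ⊕ f; n = f ⊕ (e ⊕ conℕ 2 ⊗ d) in
             conℕ 4 ⊗ (e ⊕ d) ⊕ conℕ 2 ⊗ ((conℕ 1 ⊕ n) ⊗ n) ⊜ conℕ 8 ⊗ (e ⊗ (e ⊕ conℕ 2 ⊗ d)) ⊕ conℕ 8 ⊗ (d ⊗ d)) refl f D ⟩
      8 ℕ.* (suc f ℕ.* (suc f ℕ.+ 2 ℕ.* D)) ℕ.+ 8 ℕ.* (D ℕ.* D)
        ≡⟨ cong (λ e → 8 ℕ.* (e ℕ.* (e ℕ.+ 2 ℕ.* D)) ℕ.+ 8 ℕ.* (D ℕ.* D)) (ℕₚ.suc-pred e {{ℕ.>-nonZero 0<e}}) ⟩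
      8 ℕ.* G ℕ.+ 8 ℕ.* (D ℕ.* D) ∎)
      where
      open ≡-Reasoning
      f = ℕ.pred e

    NN-1≤ : N ℕ.* N-1 ℕ.≤ 4 ℕ.* (h ℕ.* h)
    NN-1≤ = begin
      N ℕ.* N-1          ≤⟨ ℕₚ.*-monoʳ-≤ N (ℕₚ.n≤1+n N-1) ⟩
      N ℕ.* N            ≡⟨ cong (λ n → n ℕ.* n) (Layers.N≡ e (2 ℕ.* D) 0<e) ⟩
      (e ℕ.+ (e ℕ.+ 2 ℕ.* D)) ℕ.* (e ℕ.+ (e ℕ.+ 2 ℕ.* D))
        ≡⟨ solveℕ 2 (λ e d → let n = e ⊕ (e ⊕ conℕ 2 ⊗ d) in n ⊗ n ⊜ conℕ 4 ⊗ ((e ⊕ d) ⊗ (e ⊕ d))) refl e D ⟩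
      4 ℕ.* (h ℕ.* h)    ∎
      where open ℕₚ.≤-Reasoning

    -- Eight times the excess of `density` over 1/4, to be compared with 8 k₂ ν^(-2/3) = 3^(-2/3)
    -- ν^(-2/3).
    r : ℚ
    r = fromℕ 8 * density - fromℕ 2

    r*P : r * P ≡ fromℕ (4 ℕ.* k)
    r*P = begin
      r * P
        ≡⟨ solve 4 (λ a b d p → (a :* d :- b) :* p := a :* (d :* p) :- b :* p) refl (fromℕ 8) (fromℕ 2) density P ⟩
      fromℕ 8 * (density * P) - fromℕ 2 * P
        ≡⟨ cong₂ (λ x y → fromℕ 8 * x - fromℕ 2 * y) density*P (sym (fromℕ-* N N-1)) ⟩
      fromℕ 8 * fromℕ G - fromℕ 2 * fromℕ (N ℕ.* N-1)
        ≡⟨ cong₂ _-_ (fromℕ-* 8 G) (fromℕ-* 2 (N ℕ.* N-1)) ⟨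
      fromℕ (8 ℕ.* G) - fromℕ (2 ℕ.* (N ℕ.* N-1))
        ≡⟨ cong (λ x → fromℕ x - fromℕ (2 ℕ.* (N ℕ.* N-1))) 8G≡ ⟨
      fromℕ (4 ℕ.* k ℕ.+ 2 ℕ.* (N ℕ.* N-1)) - fromℕ (2 ℕ.* (N ℕ.* N-1))
        ≡⟨ cong (_- fromℕ (2 ℕ.* (N ℕ.* N-1))) (fromℕ-+ (4 ℕ.* k) _) ⟩
      fromℕ (4 ℕ.* k) + fromℕ (2 ℕ.* (N ℕ.* N-1)) - fromℕ (2 ℕ.* (N ℕ.* N-1))
        ≡⟨ solve 2 (λ x y → x :+ y :- y := x) refl (fromℕ (4 ℕ.* k)) (fromℕ (2 ℕ.* (N ℕ.* N-1))) ⟩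
      fromℕ (4 ℕ.* k) ∎
      where open ≡-Reasoning

    0≤r : 0ℚ ≤ r
    0≤r = *-cancelʳ-≤-pos P (≤-trans (≤-reflexive (*-zeroˡ P))
      (≤-trans (fromℕ-nonNeg (4 ℕ.* k)) (≤-reflexive (sym r*P))))

    H : ℚ
    H = fromℕ (h ℕ.* h)

    -- Here r = 4k / (N (N - 1)), with denominator at most 4h².
    k≤rH : fromℕ k ≤ r * H
    k≤rH = *-cancelˡ-≤-pos (fromℕ 4) (begin
      fromℕ 4 * fromℕ k          ≡⟨ fromℕ-* 4 k ⟨
      fromℕ (4 ℕ.* k)            ≡⟨ r*P ⟨
      r * P                      ≡⟨ cong (r *_) (fromℕ-* N N-1) ⟨
      r * fromℕ (N ℕ.* N-1)      ≤⟨ *-monoˡ-≤-nonNeg r {{nonNegative 0≤r}} (fromℕ-mono NN-1≤) ⟩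
      r * fromℕ (4 ℕ.* (h ℕ.* h)) ≡⟨ cong (r *_) (fromℕ-* 4 (h ℕ.* h)) ⟩
      r * (fromℕ 4 * H)          ≡⟨ solve 3 (λ r a h → r :* (a :* h) := a :* (r :* h)) refl r (fromℕ 4) H ⟩
      fromℕ 4 * (r * H)          ∎)
      where open ≤-Reasoning

    0<H : 0ℚ < H
    0<H = 0<fromℕ (ℕₚ.<-≤-trans 0<h (ℕₚ.m≤m*n h h {{ℕ.>-nonZero 0<h}}))
      where
      0<h : 0 ℕ.< h
      0<h = ℕₚ.<-≤-trans 0<e (ℕₚ.m≤m+n e D)

    0<H³ : 0ℚ < H ³
    0<H³ = ³-strict-mono ≤-refl 0<H

    fromℕ-cube : ∀ m → fromℕ (cube m) ≡ fromℕ m ³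
    fromℕ-cube m = trans (fromℕ-* (m ℕ.* m) m) (cong (_* fromℕ m) (fromℕ-* m m))

    X : ℚ
    X = fromℕ (9 ℕ.* (ν ℕ.* ν))

    -- `enough` divided by h⁶, with k / h² raised to `r`.
    1≤Xr³ : 1ℚ ≤ X * r ³
    1≤Xr³ = *-cancelʳ-≤-pos (H ³) {{positive 0<H³}} (begin
      1ℚ * H ³                ≡⟨ *-identityˡ (H ³) ⟩
      H ³                     ≡⟨ fromℕ-cube (h ℕ.* h) ⟨
      fromℕ (cube (h ℕ.* h))  ≤⟨ fromℕ-mono enough ⟩
      fromℕ (9 ℕ.* (ν ℕ.* ν) ℕ.* cube k)
        ≡⟨ trans (fromℕ-* (9 ℕ.* (ν ℕ.* ν)) (cube k)) (cong (X *_) (fromℕ-cube k)) ⟩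
      X * fromℕ k ³
        ≤⟨ *-monoˡ-≤-nonNeg X {{nonNegative (fromℕ-nonNeg (9 ℕ.* (ν ℕ.* ν)))}} (³-mono-≤ (fromℕ-nonNeg k) k≤rH) ⟩
      X * (r * H) ³
        ≡⟨ solve 3 (λ x r h → x :* (r :* h :* (r :* h) :* (r :* h)) := x :* (r :* r :* r) :* (h :* h :* h)) refl X r H ⟩
      X * r ³ * H ³           ∎)
      where open ≤-Reasoning

  -- Cubing decides: 9ν² times the cube is at most 1 for the left side and at least 1 for `r`.
  ^-⅔*^-⅔≤ : ∀ i → seq (3 ^-⅔) i * seq (ν ^-⅔) i ≤ r
  ^-⅔*^-⅔≤ i with seq (3 ^-⅔) i * seq (ν ^-⅔) i ≤? r
  ... | yes l≤r = l≤r
  ... | no  l≰r = contradiction (≤-<-trans 1≤Xr³ (begin-strict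
    X * r ³
      <⟨ *-monoʳ-<-pos X {{positive 0<X}} (³-strict-mono 0≤r (≰⇒> l≰r)) ⟩
    X * (a * b) ³
      ≡⟨ cong (_* (a * b) ³) (trans (fromℕ-* 9 (ν ℕ.* ν)) (cong (fromℕ 9 *_) (fromℕ-* ν ν))) ⟩
    fromℕ 9 * (fromℕ ν * fromℕ ν) * (a * b) ³
      ≡⟨ solve 4 (λ x n a b → x :* (n :* n) :* (a :* b :* (a :* b) :* (a :* b)) := x :* (a :* a :* a) :* (n :* n :* (b :* b :* b)))
           refl (fromℕ 9) (fromℕ ν) a b ⟩
    fromℕ 9 * a ³ * (fromℕ ν * fromℕ ν * b ³)
      ≤⟨ *-mono-1 (*-nonNeg (fromℕ-nonNeg 9) (*-nonNeg (*-nonNeg 0≤a 0≤a) 0≤a)) (n²*^-⅔³≤1 3 i) (n²*^-⅔³≤1 ν i) ⟩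
    1ℚ ∎)) (<-irrefl refl)
    where
    open ≤-Reasoning
    a = seq (3 ^-⅔) i
    b = seq (ν ^-⅔) i
    0≤a = ^-⅔-nonNeg 3 i
    0<X : 0ℚ < X
    0<X = 0<fromℕ (ℕₚ.<-≤-trans {j = 9} (ℕ.s≤s ℕ.z≤n) (ℕₚ.m≤m*n 9 (ν ℕ.* ν) {{ℕₚ.m*n≢0 ν ν}}))

  bound≤density : ∀ i → seq (¼ℝ +ℝ k₂ *ℝ ν ^-⅔) i ≤ density
  bound≤density i = begin
    ℤ.+ 1 / 4 + ℤ.+ 1 / 8 * a * b
      ≡⟨ cong (λ x → ℤ.+ 1 / 4 + x) (*-assoc (ℤ.+ 1 / 8) a b) ⟩
    ℤ.+ 1 / 4 + ℤ.+ 1 / 8 * (a * b)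
      ≤⟨ +-monoʳ-≤ (ℤ.+ 1 / 4) (*-monoˡ-≤-nonNeg (ℤ.+ 1 / 8) (^-⅔*^-⅔≤ i)) ⟩
    ℤ.+ 1 / 4 + ℤ.+ 1 / 8 * r
      ≡⟨ solve 1 (λ d → con (ℤ.+ 1 / 4) :+ con (ℤ.+ 1 / 8) :* (con (fromℕ 8) :* d :- con (fromℕ 2)) := d) refl density ⟩
    density ∎
    where
    open ≤-Reasoning
    a = seq (3 ^-⅔) i
    b = seq (ν ^-⅔) i

-- Order and finite sums of reals.

open import Data.Vec.Base using ([]; _∷_; tabulate)

pointwise⇒≤ℝ : ∀ {x y} → (∀ n → seq x n ≤ seq y n) → x ≤ℝ y
pointwise⇒≤ℝ {x} {y} x≤y ε 0<ε = 0 , λ n _ →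
  ≤-trans (x≤y n) (≤-trans (≤-reflexive (sym (+-identityʳ (seq y n)))) (+-monoʳ-≤ (seq y n) (<⇒≤ 0<ε)))

≤ℝ-trans : ∀ {x y z} → x ≤ℝ y → y ≤ℝ z → x ≤ℝ z
≤ℝ-trans {x} {y} {z} x≤y y≤z ε 0<ε with M , f ← x≤y (½ * ε) (½-pos 0<ε) | N , g ← y≤z (½ * ε) (½-pos 0<ε) =
  M ℕ.⊔ N , λ n p → begin
    seq x n                        ≤⟨ f n (ℕₚ.m⊔n≤o⇒m≤o M N p) ⟩
    seq y n + ½ * ε                ≤⟨ +-monoˡ-≤ (½ * ε) (g n (ℕₚ.m⊔n≤o⇒n≤o M N p)) ⟩
    seq z n + ½ * ε + ½ * ε        ≡⟨ solve 2 (λ z ε → z :+ con ½ :* ε :+ con ½ :* ε := z :+ ε) refl (seq z n) ε ⟩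
    seq z n + ε                    ∎
  where open ≤-Reasoning

+ℝ-mono-≤ : ∀ {w x y z} → w ≤ℝ x → y ≤ℝ z → w +ℝ y ≤ℝ x +ℝ z
+ℝ-mono-≤ {w} {x} {y} {z} w≤x y≤z ε 0<ε with M , f ← w≤x (½ * ε) (½-pos 0<ε) | N , g ← y≤z (½ * ε) (½-pos 0<ε) =
  M ℕ.⊔ N , λ n p → begin
    seq w n + seq y n                      ≤⟨ +-mono-≤ (f n (ℕₚ.m⊔n≤o⇒m≤o M N p)) (g n (ℕₚ.m⊔n≤o⇒n≤o M N p)) ⟩
    seq x n + ½ * ε + (seq z n + ½ * ε)    ≡⟨ solve 3 (λ x z ε → x :+ con ½ :* ε :+ (z :+ con ½ :* ε) := x :+ z :+ ε) refl (seq x n) (seq z n) ε ⟩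
    seq x n + seq z n + ε                  ∎
  where open ≤-Reasoning

∑-mono-≤ : ∀ {n} {f g : Fin n → ℝ} → (∀ i → f i ≤ℝ g i) → ∑ f ≤ℝ ∑ g
∑-mono-≤ {zero}          _   = pointwise⇒≤ℝ {0ℝ} {0ℝ} λ _ → ≤-refl
∑-mono-≤ {suc n} {f} {g} f≤g = +ℝ-mono-≤ {f zero} {g zero} {∑ (f ∘ suc)} {∑ (g ∘ suc)} (f≤g zero) (∑-mono-≤ (f≤g ∘ suc))

-- For x ≥ 0 the terms of `x` are eventually only at least -ε, so the error is (q - p) ε; q ≤ p + 1
-- keeps it within ε.
*ℝ-monoˡ-≤ : ∀ {p q} x → 0ℝ ≤ℝ x → p ≤ q → q ≤ p + 1ℚ → fromℚ p *ℝ x ≤ℝ fromℚ q *ℝ x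
*ℝ-monoˡ-≤ {p} {q} x 0≤x p≤q q≤p+1 ε 0<ε with N , h ← 0≤x ε 0<ε = N , λ n N≤n → begin
  p * seq x n
    ≡⟨ +-identityʳ _ ⟨
  p * seq x n + 0ℚ
    ≤⟨ +-monoʳ-≤ (p * seq x n) (*-nonNeg (≤⇒0≤- p≤q) (h n N≤n)) ⟩
  p * seq x n + (q - p) * (seq x n + ε)
    ≡⟨ solve 4 (λ p q x ε → p :* x :+ (q :- p) :* (x :+ ε) := q :* x :+ (q :- p) :* ε) refl p q (seq x n) ε ⟩
  q * seq x n + (q - p) * ε
    ≤⟨ +-monoʳ-≤ (q * seq x n) (*-monoʳ-≤-nonNeg ε {{nonNegative (<⇒≤ 0<ε)}}
         (≤⇒-≤ {q} {p} {1ℚ} q≤p+1)) ⟩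
  q * seq x n + 1ℚ * ε
    ≡⟨ cong (λ z → q * seq x n + z) (*-identityˡ ε) ⟩
  q * seq x n + ε ∎
  where open ≤-Reasoning

⨆-upper : ∀ {n} (f : Subset n → ℝ) X i → seq (f X) i ≤ seq (⨆ f) i
⨆-upper f []          i = ≤-refl
⨆-upper f (false ∷ X) i = ≤-trans (⨆-upper (λ X → f (false ∷ X)) X i)
  (p≤p⊔q (seq (⨆ (λ X → f (false ∷ X))) i) (seq (⨆ (λ X → f (true ∷ X))) i))
⨆-upper f (true ∷ X)  i = ≤-trans (⨆-upper (λ X → f (true ∷ X)) X i)
  (p≤q⊔p (seq (⨆ (λ X → f (false ∷ X))) i) (seq (⨆ (λ X → f (true ∷ X))) i))

does-∈?-tabulate : ∀ {n} (f : Fin n → Bool) u → does (u Subset.∈? tabulate f) ≡ f u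
does-∈?-tabulate f zero with f zero
... | true  = refl
... | false = refl
does-∈?-tabulate f (suc u) = does-∈?-tabulate (f ∘ suc) u

-- Expectations are taken of rationals, so linearity is used at a fixed index `i` of the
-- approximating sequences.
𝔼-∑ : ∀ {A : Set} (d : Dist A) {n} (f : A → Fin n → ℝ) (g : Fin n → ℝ) i →
  (∀ u → 𝔼 d (λ a → seq (f a u) i) ≡ seq (g u) i) →
  𝔼 d (λ a → seq (∑ (f a)) i) ≡ seq (∑ g) i
𝔼-∑ d {zero}  f g i _  = 𝔼-const d 0ℚ
𝔼-∑ d {suc n} f g i eq = trans
  (𝔼-+ d (λ a → seq (f a zero) i) (λ a → seq (∑ (f a ∘ suc)) i))
  (cong₂ _+_ (eq zero) (𝔼-∑ d (λ a → f a ∘ suc) (g ∘ suc) i (eq ∘ suc)))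

*ℝ-distribˡ-∑ : ∀ p {n} (f : Fin n → ℝ) i → p * seq (∑ f) i ≡ seq (∑ (λ u → fromℚ p *ℝ f u)) i
*ℝ-distribˡ-∑ p {zero}  f i = *-zeroʳ p
*ℝ-distribˡ-∑ p {suc n} f i = trans (*-distribˡ-+ p (seq (f zero) i) _)
  (cong (λ x → p * seq (f zero) i + x) (*ℝ-distribˡ-∑ p (f ∘ suc) i))

∑-cong : ∀ {n} (f g : Fin n → ℝ) i → (∀ u → seq (f u) i ≡ seq (g u) i) → seq (∑ f) i ≡ seq (∑ g) i
∑-cong {zero}  f g i _  = refl
∑-cong {suc n} f g i eq = cong₂ _+_ (eq zero) (∑-cong (f ∘ suc) (g ∘ suc) i (eq ∘ suc))

-- From a random cut to a heavy cut.

module _ (D : WeightedDigraph) where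
  open WeightedDigraph D

  -- Averaging: the expected weight of the random cut is at least p times the total weight, and each
  -- sample weighs at most `mac D`.
  mac-≥ : ∀ {A : Set} (d : Dist A) (S : A → Vertex → Bool) {p} → 0ℚ ≤ p →
    (∀ {u v} → Arc u v → p ≤ 𝔼 d (λ a → ⟦ S a u ⟧ * ⟦ not (S a v) ⟧)) →
    fromℚ p *ℝ totalWeight D ≤ℝ mac D
  mac-≥ d S {p} 0≤p p≤ =
    ≤ℝ-trans {fromℚ p *ℝ totalWeight D} {scaled} {mac D}
      (pointwise⇒≤ℝ {fromℚ p *ℝ totalWeight D} {scaled} λ i → ≤-reflexive (trans
        (*ℝ-distribˡ-∑ p (λ u → ∑ (w u)) i)
        (∑-cong (λ u → fromℚ p *ℝ ∑ (w u)) _ i λ u → *ℝ-distribˡ-∑ p (w u) i)))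
      (≤ℝ-trans {scaled} {expected} {mac D}
        (∑-mono-≤ λ u → ∑-mono-≤ λ v → arc-≤ u v (arc? u v))
        (pointwise⇒≤ℝ {expected} {mac D} λ i → ≤-trans
          (≤-reflexive (sym (𝔼-∑ d _ _ i λ u → 𝔼-∑ d _ _ i λ v → 𝔼-cut u v i)))
          (≤-trans (𝔼-mono d λ a → ⨆-upper (cutWeight D) (tabulate (S a)) i)
            (≤-reflexive (𝔼-const d _)))))
    where
    w : Vertex → Vertex → ℝ
    w u v = weightOf D (arc? u v)
    P : Vertex → Vertex → ℚ
    P u v = 𝔼 d (λ a → ⟦ S a u ⟧ * ⟦ not (S a v) ⟧)
    scaled expected : ℝ
    scaled = ∑ λ u → ∑ λ v → fromℚ p *ℝ w u v
    expected = ∑ λ u → ∑ λ v → fromℚ (P u v) *ℝ w u v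

    P≤1 : ∀ u v → P u v ≤ 1ℚ
    P≤1 u v = ≤-trans (𝔼-mono d λ a → bool (S a u) (S a v)) (≤-reflexive (𝔼-const d 1ℚ))
      where
      0≤1 : 0ℚ ≤ 1ℚ
      0≤1 = nonNegative⁻¹ 1ℚ
      bool : ∀ a b → ⟦ a ⟧ * ⟦ not b ⟧ ≤ 1ℚ
      bool true  true  = 0≤1
      bool true  false = ≤-refl
      bool false true  = 0≤1
      bool false false = 0≤1

    arc-≤ : ∀ u v (a? : Dec (Arc u v)) → fromℚ p *ℝ weightOf D a? ≤ℝ fromℚ (P u v) *ℝ weightOf D a?
    arc-≤ u v (yes a) = *ℝ-monoˡ-≤ (weight a) (weight≥0 a) (p≤ a)
      (≤-trans (P≤1 u v) (≤-trans (≤-reflexive (sym (+-identityˡ 1ℚ))) (+-monoˡ-≤ 1ℚ 0≤p)))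
    arc-≤ u v (no _) = pointwise⇒≤ℝ {fromℚ p *ℝ 0ℝ} {fromℚ (P u v) *ℝ 0ℝ} λ _ →
      ≤-reflexive (trans (*-zeroʳ p) (sym (*-zeroʳ (P u v))))

    𝔼-cut : ∀ u v i →
      𝔼 d (λ a → seq (if does (u Subset.∈? tabulate (S a) ×-dec ¬? (v Subset.∈? tabulate (S a))) then w u v else 0ℝ) i)
        ≡ P u v * seq (w u v) i
    𝔼-cut u v i = trans
      (𝔼-cong d λ a → trans
        (cong₂ (λ x y → seq (if x ∧ not y then w u v else 0ℝ) i)
          (does-∈?-tabulate (S a) u) (does-∈?-tabulate (S a) v))
        (bool (S a u) (S a v)))
      (𝔼-*ʳ d _ (seq (w u v) i))
      where
      bool : ∀ a b → seq (if a ∧ not b then w u v else 0ℝ) i ≡ ⟦ a ⟧ * ⟦ not b ⟧ * seq (w u v) i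
      bool true  true  = sym (*-zeroˡ (seq (w u v) i))
      bool true  false = sym (*-identityˡ (seq (w u v) i))
      bool false true  = sym (*-zeroˡ (seq (w u v) i))
      bool false false = sym (*-zeroˡ (seq (w u v) i))

-- Combining the layers, the random cut and the scale.

module _ {ν : ℕ} .{{_ : NonZero ν}} (s : Scale ν) where
  open Scale s
  open Layers e (2 ℕ.* D) 0<e

  private
    covers′ : ν ℕ.≤ suc (2 ℕ.* D) ℕ.* N
    covers′ = subst (λ n → ν ℕ.≤ suc (2 ℕ.* D) ℕ.* n) (sym N≡) covers

  density≤𝔼 : ∀ {i j} → i ℕ.< ν → j ℕ.< i → density s ≤ 𝔼 cut (λ x → separates x i j)
  density≤𝔼 {i} {j} i<ν j<i =
    ≤⇒density≤ s {𝔼 cut (λ x → separates x i j)} (cut-separates {i} {j} j<i (ℕₚ.<-≤-trans i<ν covers′))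

density-attained : ∀ {ν} .{{_ : NonZero ν}} (s : Scale ν) D → Acyclic D → LongestPathHasOrder D ν →
  fromℚ (density s) *ℝ totalWeight D ≤ℝ mac D
density-attained {ν} s D acyclic longest = from-layering (layering D acyclic ν longest)
  where
  open WeightedDigraph D using (Arc)
  from-layering : (∃[ ℓ ] (∀ v → ℓ v ℕ.< ν) × (∀ {u v} → Arc u v → ℓ v ℕ.< ℓ u)) →
    fromℚ (density s) *ℝ totalWeight D ≤ℝ mac D
  from-layering (ℓ , ℓ<ν , ℓ-mono) =
    -- A vertex joins the cut exactly if its layer is drawn.
    mac-≥ D (Layers.cut _ _ (Scale.0<e s)) (λ x v → x (ℓ v)) {density s} (density-nonNeg s)
      λ {u} {v} a → density≤𝔼 s (ℓ<ν u) (ℓ-mono a)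

mainTheorem15 : (ν : ℕ) .{{_ : NonZero ν}} → ¼ℝ +ℝ k₂ *ℝ ν ^-⅔ ≤ᴸ c ν
mainTheorem15 ν q (ε , 0<ε , N , q+ε≤) =
  -- The rational `density s` is itself one of the constants whose supremum is `c ν`, and it
  -- dominates every term of the bound, so `ε` and `N` carry over.
  fromℚ (density s) ,
  (pointwise⇒≤ℝ {0ℝ} {fromℚ (density s)} (λ _ → density-nonNeg s) , density-attained s) ,
  ε , 0<ε , N , λ n N≤n → ≤-trans (q+ε≤ n N≤n) (bound≤density s n)
  where s = scale ν
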